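{- For all integers $p,q\ge2$, the labelled Diestel–Leader graph $\mathrm{DL}(p,q)$ has undecidable seeded tiling problem: there is no algorithm which, given a finite set $C$, a subset $\Pi\subseteq C\times(\{0,\dots,p-1\}\times\{0,\dots,q-1\})\times C$ and $c_0\in C$, decides whether there is a colouring $\kappa\colon V(\mathrm{DL}(p,q))\to C$ with $\kappa(o)=c_0$ and $(\kappa(x),\ell(e),\kappa(y))\in\Pi$ for every edge $e$ of $\mathrm{DL}(p,q)$, where $x$ is the endpoint of $e$ with smaller marker position, $y$ the one with larger marker position, and $\ell(e)$ the label of $e$.
   Context: **Vertices.** A vertex of $\mathrm{DL}(p,q)$ is a pair $(n,x)$, where $n\in\mathbb Z$ is the marker position and $x\colon\mathbb Z+\tfrac12\to\mathbb N$ is finitely supported. It is required that $x(i)\in\{0,\dots,q-1\}$ for $i<n$ and $x(i)\in\{0,\dots,p-1\}$ for $i>n$. **Edges.** Two vertices $(n,x)$ and $(n+1,y)$ are joined by an edge if and only if $x$ and $y$ agree at every position except possibly $n+\tfrac12$. Such an edge has label $(x(n+\tfrac12),y(n+\tfrac12))\in\{0,\dots,p-1\}\times\{0,\dots,q-1\}$. There are no other edges. **Seed.** The seed vertex $o$ is the vertex with marker $0$ and $x\equiv0$. (Equivalently, $\mathrm{DL}(p,q)$ is the horocyclic product of a $(p+1)$-regular and a $(q+1)$-regular tree, with this natural edge labelling.) -}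

module Defs where

open import Data.Nat as ℕ using (ℕ; zero; suc; _+_; _*_)
open import Data.Integer as ℤ using (ℤ; ∣_∣)
open import Data.Fin using (Fin; toℕ)
open import Data.Vec using (Vec; []; _∷_; lookup)
open import Data.List using (List; []; _∷_; _++_)
open import Data.List.Membership.Propositional using (_∈_)
open import Data.Product using (Σ; ∃; _×_; _,_)
open import Relation.Binary.PropositionalEquality using (_≡_; _≢_)

-- The Diestel–Leader graph DL(p,q)
-- Position i + ½ (i ∈ ℤ) is indexed by the integer i.
-- Position i+½ < n  iff  i < n ;  position i+½ > n  iff  n ≤ i.

record Vertex (p q : ℕ) : Set where
  field
    pos     : ℤ
    lab     : ℤ → ℕ                   -- x, with lab i = x(i + ½)
    below   : ∀ i → i ℤ.< pos → lab i ℕ.< q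
    above   : ∀ i → pos ℤ.≤ i → lab i ℕ.< p
    finSupp : ∃ λ (N : ℕ) → ∀ i → N ℕ.≤ ∣ i ∣ → lab i ≡ 0
open Vertex public

SameVertex : ∀ {p q} → Vertex p q → Vertex p q → Set
SameVertex v w = (pos v ≡ pos w) × (∀ i → lab v i ≡ lab w i)

Edge : ∀ {p q} → Vertex p q → Vertex p q → Set
Edge v w = (pos w ≡ pos v ℤ.+ ℤ.1ℤ) × (∀ i → i ≢ pos v → lab v i ≡ lab w i)

record Instance (p q : ℕ) : Set where
  field
    k  : ℕ
    c₀ : Fin k
    Π  : List (Fin k × Fin p × Fin q × Fin k)
open Instance public

-- κ is a colouring of the vertices; the edge with endpoints v (smaller marker)
-- and w (larger marker) has label (x(n+½), y(n+½)) = (lab v (pos v), lab w (pos v)).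
IsTiling : ∀ {p q} (I : Instance p q) → (Vertex p q → Fin (k I)) → Set
IsTiling {p} {q} I κ =
    (∀ v w → SameVertex v w → κ v ≡ κ w)
  × (∀ v → pos v ≡ ℤ.0ℤ → (∀ i → lab v i ≡ 0) → κ v ≡ c₀ I)
  × (∀ v w → Edge v w →
       Σ (Fin p) λ a → Σ (Fin q) λ b →
         (toℕ a ≡ lab v (pos v)) × (toℕ b ≡ lab w (pos v))
         × ((κ v , a , b , κ w) ∈ Π I))

Tileable : ∀ {p q} → Instance p q → Set
Tileable {p} {q} I = Σ (Vertex p q → Fin (k I)) λ κ → IsTiling I κ

-- Encoding instances as natural numbers (Cantor pairing of lists)

tri : ℕ → ℕ
tri zero    = zero
tri (suc n) = suc n + tri n

pair : ℕ → ℕ → ℕ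
pair a b = tri (a + b) + b

codeList : List ℕ → ℕ
codeList []       = 0
codeList (a ∷ as) = suc (pair a (codeList as))

codeΠ : ∀ {k p q} → List (Fin k × Fin p × Fin q × Fin k) → List ℕ
codeΠ [] = []
codeΠ ((a , b , c , d) ∷ r) = toℕ a ∷ toℕ b ∷ toℕ c ∷ toℕ d ∷ codeΠ r

code : ∀ {p q} → Instance p q → ℕ
code I = codeList (k I ∷ toℕ (c₀ I) ∷ codeΠ (Π I))

data PR : ℕ → Set where
  zer  : ∀ {n} → PR n
  succ : PR 1
  proj : ∀ {n} → Fin n → PR n
  comp : ∀ {m n} → PR m → Vec (PR n) m → PR n
  prec : ∀ {n} → PR n → PR (suc (suc n)) → PR (suc n)
  mu   : ∀ {n} → PR (suc n) → PR n

mutual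
  data _⟦_⟧⇓_ : ∀ {n} → PR n → Vec ℕ n → ℕ → Set where
    ev-zer  : ∀ {n} {xs : Vec ℕ n} → zer ⟦ xs ⟧⇓ 0
    ev-succ : ∀ {x} → succ ⟦ x ∷ [] ⟧⇓ suc x
    ev-proj : ∀ {n} {xs : Vec ℕ n} (i : Fin n) → proj i ⟦ xs ⟧⇓ lookup xs i
    ev-comp : ∀ {m n} {f : PR m} {gs : Vec (PR n) m} {xs ys y}
            → gs ⟦ xs ⟧⇓* ys → f ⟦ ys ⟧⇓ y → comp f gs ⟦ xs ⟧⇓ y
    ev-prec0 : ∀ {n} {g : PR n} {h} {xs y}
             → g ⟦ xs ⟧⇓ y → prec g h ⟦ 0 ∷ xs ⟧⇓ y
    ev-precS : ∀ {n} {g : PR n} {h} {xs x r y}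
             → prec g h ⟦ x ∷ xs ⟧⇓ r → h ⟦ x ∷ r ∷ xs ⟧⇓ y
             → prec g h ⟦ suc x ∷ xs ⟧⇓ y
    ev-mu   : ∀ {n} {f : PR (suc n)} {xs y}
            → f ⟦ y ∷ xs ⟧⇓ 0
            → (∀ z → z ℕ.< y → ∃ λ r → f ⟦ z ∷ xs ⟧⇓ suc r)
            → mu f ⟦ xs ⟧⇓ y

  data _⟦_⟧⇓*_ : ∀ {m n} → Vec (PR n) m → Vec ℕ n → Vec ℕ m → Set where
    ev-[] : ∀ {n} {xs : Vec ℕ n} → [] ⟦ xs ⟧⇓* []
    ev-∷  : ∀ {m n} {g : PR n} {gs : Vec (PR n) m} {xs y ys}
          → g ⟦ xs ⟧⇓ y → gs ⟦ xs ⟧⇓* ys → (g ∷ gs) ⟦ xs ⟧⇓* (y ∷ ys)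

open import Data.Sum using (_⊎_)
open import Relation.Nullary using (¬_)

Decides : ∀ {p q} → PR 1 → Set
Decides {p} {q} f = (I : Instance p q) →
    (f ⟦ code I ∷ [] ⟧⇓ 1 × Tileable I) ⊎ (f ⟦ code I ∷ [] ⟧⇓ 0 × ¬ Tileable I)

{-# OPTIONS --safe #-}
-- A configuration of a Turing machine with tape alphabet {0,1}, the head standing between two
-- cells, is a vertex (n,x) with a state. Reading a, writing b and moving right is walking up an
-- edge labelled (a,b); reading b, writing a and moving left is walking down one. Colour each
-- vertex by the set of states in which the machine visits it: the local rules say that these sets
-- are closed under the moves and avoid a bad state, so a run that ends badly excludes a tiling,
-- and a run that ends well yields one, with the empty set off the run.
--
-- No universal machine is needed. The rules of a machine form a fixed list with code n. To this
-- list one prepends the rules of a chain of n+2 further colours which starts at the seed and is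
-- forced to walk down writing n+2 ones, after which the machine starts with its own code n in
-- unary on the tape. The code of the whole instance is a recursive function of n alone, so the
-- machine can compute what an alleged decision procedure f says about its own instance, and then
-- do the opposite.
module Submission where

open import Defs
open import Data.Nat
open import Data.Nat.Properties
open import Data.Nat.Tactic.RingSolver using (solve-∀)
open import Data.Bool using (Bool; true; false; not; _∧_; T; if_then_else_)
open import Data.Bool.Properties using (T?; not-involutive)
open import Data.Empty using (⊥; ⊥-elim)
open import Data.Fin as Fin using (Fin; toℕ; fromℕ<)
open import Data.Fin.Properties using (toℕ-fromℕ<; toℕ-injective)
import Data.Integer as ℤ
import Data.Integer.Properties as ℤ
open import Algebra.Properties.AbelianGroup ℤ.+-0-abelianGroup using () renaming (∙-cancelʳ to ℤ-cancelʳ)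
open import Data.List as List
  using (List; []; _∷_; [_]; _++_; _ʳ++_; length; replicate; applyUpTo; upTo; filter; cartesianProduct)
open import Data.List.Properties
  using (++-ʳ++; ++-assoc; ++-identityʳ; length-++; length-replicate; length-applyUpTo)
open import Data.List.Membership.Propositional using (_∈_; find; lose)
open import Data.List.Membership.Propositional.Properties
  using (∈-map⁺; ∈-map⁻; ∈-++⁺ˡ; ∈-++⁺ʳ; ∈-++⁻; ∈-upTo⁺; ∈-upTo⁻; ∈-filter⁺; ∈-filter⁻;
         ∈-cartesianProduct⁺; ∈-cartesianProduct⁻)
open import Data.List.Relation.Unary.All as All using (All; []; _∷_)
open import Data.List.Relation.Unary.Any using (here; there; any?)
open import Data.Product using (Σ; ∃; _×_; _,_; proj₁; proj₂)
open import Data.Sum using (_⊎_; inj₁; inj₂)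
open import Data.Unit using (⊤; tt)
open import Data.Vec as Vec using (Vec; []; _∷_; lookup)
open import Data.Vec.Properties using (lookup-map)
open import Data.Vec.Membership.Propositional.Properties using (∈-lookup)
import Data.Vec.Relation.Unary.All as VecAll
open VecAll using ([]; _∷_)
open import Function using (_∘_; id; const; mk⇔)
open import Relation.Binary using (tri<; tri≈; tri>)
open import Relation.Binary.PropositionalEquality hiding ([_])
open import Relation.Nullary using (¬_; Dec; yes; no; contradiction)
open import Relation.Nullary.Decidable
  using (_→-dec_; _×-dec_; ¬?; map′; does; dec-true; dec-false; does-⇔; toWitness; isYes≗does)
open import Relation.Unary using (Decidable)

-- Tape programs

-- A vertex holds the whole tape and the head position, so a vertex with a state is a full
-- configuration and time needs no coordinate; one vertex can be visited in several states, which is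
-- why the colours are sets. Only runs that end matter, as a decision procedure answers on every
-- instance. A finite run also makes the colouring computable: whether a vertex is visited is a
-- finite check. The self-reference is not circular. The chain rules are copies of a template that
-- depends on `p` and `q` alone, so the map `selfCode` from `n` to the code of the instance is
-- available before the machine that evaluates it. The fixed rules cannot know the length of the
-- chain, so the only chain colour that they treat specially is the last one, where the machine
-- starts. Conversely the number of colours is read off the length of the chain, which therefore has
-- to exceed every colour in the fixed rules.

Tape : Set
Tape = List Bool × List Bool

hd : List Bool → Bool
hd []      = false
hd (a ∷ _) = a

tl : List Bool → List Bool
tl []      = []
tl (_ ∷ r) = r

data Dir : Set where
  ◂ ▸ : Dir

-- The left list is read outwards from the head. Blanks continue the tape on the right, through `hd`
-- and `tl`, but not on the left: there is no move across the left end, so a run cannot touch what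
-- lies beyond it.
data Move : Dir → Bool → Bool → Tape → Tape → Set where
  right : ∀ {a b l r} → hd r ≡ a → Move ▸ a b (l , r) (b ∷ l , tl r)
  left  : ∀ {a b l r} → Move ◂ a b (a ∷ l , r) (l , b ∷ r)

data Action (X : Set) : Set where
  move      : Dir → (Bool → Bool) → (Bool → X) → Action X
  good bad  : Action X

data Reach {X : Set} (Δ : X → Action X) : X × Tape → X × Tape → Set where
  stop : ∀ {c} → Reach Δ c c
  step : ∀ {x d w nx a τ τ′ c} → Δ x ≡ move d w nx → Move d a (w a) τ τ′
       → Reach Δ (nx a , τ′) c → Reach Δ (x , τ) c

Reach-trans : ∀ {X Δ} {c d e : X × Tape} → Reach Δ c d → Reach Δ d e → Reach Δ c e
Reach-trans stop           s = s
Reach-trans (step eq m r)  s = step eq m (Reach-trans r s)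

infixr 5 _⨾_

-- scan d z walks in direction d through a block of 1s up to the next 0, which it replaces by z;
-- iter s t u is the loop: s; read a cell to the right; if it is 0 do t and exit, else do u and repeat.
data Prog : Set where
  done : Prog
  _⨾_  : Prog → Prog → Prog
  scan : Dir → Bool → Prog
  rd   : Dir → (Bool → Bool) → Prog → Prog → Prog
  iter : Prog → Prog → Prog → Prog

data Exec : Prog → Tape → Tape → Set where
  done  : ∀ {τ} → Exec done τ τ
  _⨾_   : ∀ {s t τ τ₁ τ₂} → Exec s τ τ₁ → Exec t τ₁ τ₂ → Exec (s ⨾ t) τ τ₂
  scan₀ : ∀ {d z τ τ₁} → Move d false z τ τ₁ → Exec (scan d z) τ τ₁
  scan₁ : ∀ {d z τ τ₁ τ₂} → Move d true true τ τ₁ → Exec (scan d z) τ₁ τ₂ → Exec (scan d z) τ τ₂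
  rd₀   : ∀ {d w s t τ τ₁ τ₂} → Move d false (w false) τ τ₁ → Exec s τ₁ τ₂ → Exec (rd d w s t) τ τ₂
  rd₁   : ∀ {d w s t τ τ₁ τ₂} → Move d true (w true) τ τ₁ → Exec t τ₁ τ₂ → Exec (rd d w s t) τ τ₂
  iter₀ : ∀ {s t u τ τ₁ τ₂ τ₃} → Exec s τ τ₁ → Move ▸ false false τ₁ τ₂ → Exec t τ₂ τ₃
        → Exec (iter s t u) τ τ₃
  iter₁ : ∀ {s t u τ τ₁ τ₂ τ₃ τ₄} → Exec s τ τ₁ → Move ▸ true true τ₁ τ₂ → Exec u τ₂ τ₃
        → Exec (iter s t u) τ₃ τ₄ → Exec (iter s t u) τ τ₄

result-≡ : ∀ {t τ τ₁ τ₂} → τ₁ ≡ τ₂ → Exec t τ τ₁ → Exec t τ τ₂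
result-≡ refl p = p

State : Prog → Set
State done         = ⊥
State (s ⨾ t)      = State s ⊎ State t
State (scan _ _)   = ⊤
State (rd _ _ s t) = ⊤ ⊎ (State s ⊎ State t)
State (iter s t u) = ⊤ ⊎ (State s ⊎ (State t ⊎ State u))

entry : ∀ {X : Set} (t : Prog) → (State t → X) → X → X
entry done         ι e = e
entry (s ⨾ t)      ι e = entry s (ι ∘ inj₁) (entry t (ι ∘ inj₂) e)
entry (scan _ _)   ι e = ι tt
entry (rd _ _ _ _) ι e = ι (inj₁ tt)
entry (iter s _ _) ι e = entry s (ι ∘ inj₂ ∘ inj₁) (ι (inj₁ tt))

-- The states of t are embedded by ι into those of a larger machine, and e is the state that
-- the larger machine is in when t has finished.
act : ∀ {X : Set} (t : Prog) → (State t → X) → X → State t → Action X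
act (s ⨾ t) ι e (inj₁ x) = act s (ι ∘ inj₁) (entry t (ι ∘ inj₂) e) x
act (s ⨾ t) ι e (inj₂ x) = act t (ι ∘ inj₂) e x
act (scan d z) ι e tt = move d (λ a → if a then true else z) (λ a → if a then ι tt else e)
act (rd d w s t) ι e (inj₁ tt) =
  move d w (λ a → if a then entry t (ι ∘ inj₂ ∘ inj₂) e else entry s (ι ∘ inj₂ ∘ inj₁) e)
act (rd d w s t) ι e (inj₂ (inj₁ x)) = act s (ι ∘ inj₂ ∘ inj₁) e x
act (rd d w s t) ι e (inj₂ (inj₂ x)) = act t (ι ∘ inj₂ ∘ inj₂) e x
act (iter s t u) ι e (inj₁ tt) =
  move ▸ id (λ a → if a then entry u (ι ∘ inj₂ ∘ inj₂ ∘ inj₂) (entry (iter s t u) ι e)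
                        else entry t (ι ∘ inj₂ ∘ inj₂ ∘ inj₁) e)
act (iter s t u) ι e (inj₂ (inj₁ x)) = act s (ι ∘ inj₂ ∘ inj₁) (ι (inj₁ tt)) x
act (iter s t u) ι e (inj₂ (inj₂ (inj₁ x))) = act t (ι ∘ inj₂ ∘ inj₂ ∘ inj₁) e x
act (iter s t u) ι e (inj₂ (inj₂ (inj₂ x))) =
  act u (ι ∘ inj₂ ∘ inj₂ ∘ inj₂) (entry (iter s t u) ι e) x

-- The hypothesis says that `Δ` treats the embedded states as `t` prescribes; subprograms inherit it
-- by composing `ι` with injections, so the induction stays inside one fixed machine.
Exec⇒Reach : ∀ {X} {Δ : X → Action X} {t τ τ′} (ι : State t → X) (e : X)
           → (∀ s → Δ (ι s) ≡ act t ι e s)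
           → Exec t τ τ′ → Reach Δ (entry t ι e , τ) (e , τ′)
Exec⇒Reach ι e h done      = stop
Exec⇒Reach ι e h (p ⨾ q)   =
  Reach-trans (Exec⇒Reach (ι ∘ inj₁) _ (h ∘ inj₁) p) (Exec⇒Reach (ι ∘ inj₂) e (h ∘ inj₂) q)
Exec⇒Reach ι e h (scan₀ m)   = step (h tt) m stop
Exec⇒Reach ι e h (scan₁ m p) = step (h tt) m (Exec⇒Reach ι e h p)
Exec⇒Reach ι e h (rd₀ m p)   =
  step (h (inj₁ tt)) m (Exec⇒Reach (ι ∘ inj₂ ∘ inj₁) e (h ∘ inj₂ ∘ inj₁) p)
Exec⇒Reach ι e h (rd₁ m p)   =
  step (h (inj₁ tt)) m (Exec⇒Reach (ι ∘ inj₂ ∘ inj₂) e (h ∘ inj₂ ∘ inj₂) p)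
Exec⇒Reach ι e h (iter₀ p m q) =
  Reach-trans (Exec⇒Reach (ι ∘ inj₂ ∘ inj₁) _ (h ∘ inj₂ ∘ inj₁) p)
    (step (h (inj₁ tt)) m
      (Exec⇒Reach (ι ∘ inj₂ ∘ inj₂ ∘ inj₁) e (h ∘ inj₂ ∘ inj₂ ∘ inj₁) q))
Exec⇒Reach ι e h (iter₁ p m q r) =
  Reach-trans (Exec⇒Reach (ι ∘ inj₂ ∘ inj₁) _ (h ∘ inj₂ ∘ inj₁) p)
    (step (h (inj₁ tt)) m
      (Reach-trans (Exec⇒Reach (ι ∘ inj₂ ∘ inj₂ ∘ inj₂) _ (h ∘ inj₂ ∘ inj₂ ∘ inj₂) q)
        (Exec⇒Reach ι e h r)))

-- Register contents as blocks on the tape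

ones zeros : ℕ → List Bool
ones  n = replicate n true
zeros n = replicate n false

-- The register contents r₀, r₁, … are written as the blocks 0 1^r₀ 0 1^r₁ ….
enc : List ℕ → List Bool
enc []       = []
enc (r ∷ rs) = false ∷ ones r ++ enc rs

encʳ : List ℕ → List Bool
encʳ []       = []
encʳ (r ∷ rs) = ones r ++ false ∷ encʳ rs

rep : ℕ → Prog → Prog
rep zero    t = done
rep (suc n) t = t ⨾ rep n t

rep-snoc : ∀ n {t τ τ₁ τ₂} → Exec (rep n t) τ τ₁ → Exec t τ₁ τ₂ → Exec (rep (suc n) t) τ τ₂
rep-snoc zero    done    q = q ⨾ done
rep-snoc (suc n) (p ⨾ r) q = p ⨾ rep-snoc n r q

-- The last two exchange a block with the 0 beside it by writing at the two ends of the block only.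
-- `insert₀` walks right and turns 1^r 0 into 0 1^r, `delete₀` walks left and turns 0 1^r into 1^r
-- 0; the branch on 0 is the empty block.
skipʳ skipˡ insert₀ delete₀ : Prog
skipʳ   = scan ▸ false
skipˡ   = scan ◂ false
insert₀ = rd ▸ (const false) done (scan ▸ true)
delete₀ = rd ◂ (const false) done (scan ◂ true)

hd-zeros : ∀ m → hd (zeros m) ≡ false
hd-zeros zero    = refl
hd-zeros (suc m) = refl

hd-enc : ∀ rs {Q} → hd Q ≡ false → hd (enc rs ++ Q) ≡ false
hd-enc []      h = h
hd-enc (_ ∷ _) h = refl

tl-zeros : ∀ m → tl (zeros m) ≡ zeros (pred m)
tl-zeros zero    = refl
tl-zeros (suc m) = refl

ones-ʳ++ : ∀ n {l : List Bool} → ones n ʳ++ l ≡ ones n ++ l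
ones-ʳ++ zero    = refl
ones-ʳ++ (suc n) {l} = trans (ones-ʳ++ n) (snoc n)
  where
  snoc : ∀ n → ones n ++ true ∷ l ≡ true ∷ ones n ++ l
  snoc zero    = refl
  snoc (suc n) = cong (true ∷_) (snoc n)

scanʳ : ∀ r {z l Q} → hd Q ≡ false
      → Exec (scan ▸ z) (l , ones r ++ Q) ((ones r ++ [ z ]) ʳ++ l , tl Q)
scanʳ zero    h = scan₀ (right h)
scanʳ (suc r) h = scan₁ (right refl) (scanʳ r h)

scanˡ : ∀ r {z l Q} → Exec (scan ◂ z) (ones r ++ false ∷ l , Q) (l , z ∷ ones r ++ Q)
scanˡ r {z} {l} {Q} = result-≡ (cong (λ u → l , z ∷ u) (ones-ʳ++ r)) (go r)
  where
  go : ∀ r {Q} → Exec (scan ◂ z) (ones r ++ false ∷ l , Q) (l , z ∷ ones r ʳ++ Q)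
  go zero    = scan₀ left
  go (suc r) = scan₁ left (go r)

skipʳ-blocks : ∀ xs r {l Q} → hd Q ≡ false
             → Exec (rep (suc (length xs)) skipʳ) (l , ones r ++ enc xs ++ Q)
                    ((ones r ++ enc xs ++ [ false ]) ʳ++ l , tl Q)
skipʳ-blocks []       r h = scanʳ r h ⨾ done
skipʳ-blocks (x ∷ xs) r {l} {Q} h =
  subst₂ (λ u v → Exec _ (l , ones r ++ false ∷ u) (v , tl Q))
    (sym (++-assoc (ones x) (enc xs) Q)) eq
    (scanʳ r refl ⨾ skipʳ-blocks xs x h)
  where
  eq : (ones x ++ enc xs ++ [ false ]) ʳ++ ((ones r ++ [ false ]) ʳ++ l)
     ≡ (ones r ++ false ∷ (ones x ++ enc xs) ++ [ false ]) ʳ++ l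
  eq = begin
    (ones x ++ enc xs ++ [ false ]) ʳ++ ((ones r ++ [ false ]) ʳ++ l)
      ≡⟨ cong (_ʳ++ _) (++-assoc (ones x) (enc xs) _) ⟨
    ((ones x ++ enc xs) ++ [ false ]) ʳ++ ((ones r ++ [ false ]) ʳ++ l)
      ≡⟨ ++-ʳ++ (ones r ++ [ false ]) ⟨
    ((ones r ++ [ false ]) ++ (ones x ++ enc xs) ++ [ false ]) ʳ++ l
      ≡⟨ cong (_ʳ++ l) (++-assoc (ones r) _ _) ⟩
    (ones r ++ false ∷ (ones x ++ enc xs) ++ [ false ]) ʳ++ l ∎
    where open ≡-Reasoning

-- Common induction for the leftward sweeps, which replace each block 0 1^x by `f x`. The rightmost
-- block is met first, so the step for the first register comes last.
rep-enc : ∀ {t} (f : ℕ → List Bool) (g : List ℕ → List Bool)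
        → (∀ {Q} → Q ≡ g [] ++ Q) → (∀ {x xs Q} → f x ++ g xs ++ Q ≡ g (x ∷ xs) ++ Q)
        → (∀ x {l Q} → Exec t (ones x ++ false ∷ l , Q) (l , f x ++ Q))
        → ∀ xs {l Q} → Exec (rep (length xs) t) (enc xs ʳ++ l , Q) (l , g xs ++ Q)
rep-enc f g g[] g∷ ex [] {l} = result-≡ (cong (l ,_) g[]) done
rep-enc {t} f g g[] g∷ ex (x ∷ xs) {l} {Q} =
  rep-snoc (length xs)
    (subst (λ u → Exec _ (u , Q) (ones x ++ false ∷ l , g xs ++ Q)) eq (rep-enc f g g[] g∷ ex xs))
    (result-≡ (cong (l ,_) g∷) (ex x))
  where
  eq : enc xs ʳ++ (ones x ++ false ∷ l) ≡ enc (x ∷ xs) ʳ++ l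
  eq = trans (cong (enc xs ʳ++_) (sym (ones-ʳ++ x))) (sym (++-ʳ++ (ones x)))

skipˡ-blocks : ∀ xs {l Q} → Exec (rep (length xs) skipˡ) (enc xs ʳ++ l , Q) (l , enc xs ++ Q)
skipˡ-blocks = rep-enc (λ x → false ∷ ones x) enc refl
  (λ {x} {xs} {Q} → cong (false ∷_) (sym (++-assoc (ones x) (enc xs) Q))) (λ x → scanˡ x)

delete₀-blocks : ∀ xs {l Q} → Exec (rep (length xs) delete₀) (enc xs ʳ++ l , Q) (l , encʳ xs ++ Q)
delete₀-blocks = rep-enc (λ x → ones x ++ [ false ]) encʳ refl
  (λ {x} {xs} {Q} → trans (++-assoc (ones x) _ _) (sym (++-assoc (ones x) _ Q))) del
  where
  del : ∀ x {l Q} → Exec delete₀ (ones x ++ false ∷ l , Q) (l , (ones x ++ [ false ]) ++ Q)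
  del zero    = rd₀ left done
  del (suc x) {l} {Q} = rd₁ left
    (result-≡ (cong (λ u → l , true ∷ u) (sym (++-assoc (ones x) _ Q))) (scanˡ x))

-- A sweep of `delete₀` leaves each 0 behind its block. One more 0 on the left makes the tape an
-- encoding again.
false∷encʳ : ∀ xs {Q} → false ∷ encʳ xs ++ Q ≡ enc xs ++ false ∷ Q
false∷encʳ []       = refl
false∷encʳ (x ∷ xs) {Q} = cong (false ∷_) (trans (++-assoc (ones x) _ Q)
  (trans (cong (ones x ++_) (false∷encʳ xs)) (sym (++-assoc (ones x) _ _))))

insert₀-block : ∀ r {l Q} → hd Q ≡ false → Exec insert₀ (l , ones r ++ Q) (enc [ r ] ʳ++ l , tl Q)
insert₀-block zero    h = rd₀ (right h) done
insert₀-block (suc r) {l} {Q} h = rd₁ (right refl)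
  (result-≡ (cong (λ u → u ʳ++ (false ∷ l) , tl Q) (snoc r)) (scanʳ r h))
  where
  snoc : ∀ r → ones r ++ [ true ] ≡ ones (suc r) ++ []
  snoc zero    = refl
  snoc (suc r) = cong (true ∷_) (snoc r)

insert₀-blocks : ∀ ys {l Q} → hd Q ≡ false
               → Exec (rep (length ys) insert₀) (l , tl (enc ys ++ Q)) (enc ys ʳ++ l , tl Q)
insert₀-blocks []       h = done
insert₀-blocks (y ∷ ys) {l} {Q} h =
  subst₂ (λ u v → Exec _ (l , u) (v , tl Q)) (sym (++-assoc (ones y) _ _))
    (trans (sym (++-ʳ++ (enc [ y ]))) (cong (λ u → (false ∷ u) ʳ++ l)
      (trans (++-assoc (ones y) [] _) refl)))
    (insert₀-block y (hd-enc ys h) ⨾ insert₀-blocks ys h)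

-- The number of blanks written out at the right end varies along a run and carries no information,
-- so it is left open.
Home : List ℕ → Tape → Set
Home rs τ = ∃ λ m → τ ≡ ([] , enc rs ++ zeros m)

enc-++ : ∀ xs ys → enc (xs ++ ys) ≡ enc xs ++ enc ys
enc-++ []       ys = refl
enc-++ (x ∷ xs) ys = cong (false ∷_) (trans (cong (ones x ++_) (enc-++ xs ys))
  (sym (++-assoc (ones x) _ _)))

enc-at : ∀ xs r ys Q → enc (xs ++ r ∷ ys) ++ Q ≡ enc xs ++ false ∷ ones r ++ enc ys ++ Q
enc-at xs r ys Q = trans (cong (_++ Q) (enc-++ xs (r ∷ ys)))
  (trans (++-assoc (enc xs) _ Q) (cong (λ u → enc xs ++ false ∷ u) (++-assoc (ones r) _ Q)))

-- The new 1 overwrites the 0 that opens the next register. Each `insert₀` puts back the missing 0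
-- and consumes the following one, until a blank is consumed at the end.
incProg : ℕ → ℕ → Prog
incProg i j = rep (suc i) skipʳ ⨾ scan ▸ true ⨾ rep j insert₀ ⨾ rep (i + suc j) skipˡ

entered : List ℕ → List Bool
entered xs = (enc xs ++ [ false ]) ʳ++ []

enter : ∀ xs r ys {m} →
  Exec (rep (suc (length xs)) skipʳ) ([] , enc (xs ++ r ∷ ys) ++ zeros m)
       (entered xs , ones r ++ enc ys ++ zeros m)
enter xs r ys {m} = subst (λ u → Exec _ ([] , u) (entered xs , ones r ++ enc ys ++ zeros m))
  (sym (enc-at xs r ys _)) (skipʳ-blocks xs 0 refl)

leave : ∀ xs r ys → enc ys ʳ++ (ones r ʳ++ entered xs) ≡ enc (xs ++ r ∷ ys) ʳ++ []
leave xs r ys = begin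
  enc ys ʳ++ (ones r ʳ++ ((enc xs ++ [ false ]) ʳ++ []))  ≡⟨ ++-ʳ++ (ones r) ⟨
  (ones r ++ enc ys) ʳ++ ((enc xs ++ [ false ]) ʳ++ [])   ≡⟨ ++-ʳ++ (enc xs ++ [ false ]) ⟨
  ((enc xs ++ [ false ]) ++ ones r ++ enc ys) ʳ++ []      ≡⟨ cong (_ʳ++ []) (++-assoc (enc xs) _ _) ⟩
  (enc xs ++ enc (r ∷ ys)) ʳ++ []                         ≡⟨ cong (_ʳ++ []) (enc-++ xs (r ∷ ys)) ⟨
  enc (xs ++ r ∷ ys) ʳ++ []                               ∎
  where open ≡-Reasoning


inc-correct : ∀ {i j rs rs′ τ} xs r ys → length xs ≡ i → length ys ≡ j
            → rs ≡ xs ++ r ∷ ys → rs′ ≡ xs ++ suc r ∷ ys → Home rs τ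
            → ∃ λ τ′ → Exec (incProg i j) τ τ′ × Home rs′ τ′
inc-correct xs r ys refl refl refl refl (m , refl) = _ ,
  ( enter xs r ys
  ⨾ scanʳ r (hd-enc ys (hd-zeros m))
  ⨾ insert₀-blocks ys (hd-zeros m)
  ⨾ subst₂ (λ n u → Exec (rep n skipˡ) (u , tl (zeros m)) ([] , enc (xs ++ suc r ∷ ys) ++ tl (zeros m)))
      (length-++ xs) (trans (sym (leave xs (suc r) ys)) (cong (λ u → enc ys ʳ++ (u ʳ++ entered xs)) (snoc r)))
      (skipˡ-blocks (xs ++ suc r ∷ ys))) ,
  pred m , cong (λ u → [] , enc (xs ++ suc r ∷ ys) ++ u) (tl-zeros m)
  where
  snoc : ∀ r → ones (suc r) ≡ ones r ++ [ true ]
  snoc zero    = refl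
  snoc (suc r) = cong (true ∷_) (snoc r)

-- After a 1, the head goes to the far end and comes back with `delete₀`, moving the `j` later
-- blocks one cell to the left; the last 1 of register `i` then becomes the 0 in front of them.
-- After a 0, the head has already passed that 0, hence `2 + i` scans on the way back rather than
-- `suc i`.
loopProg : ℕ → ℕ → Prog → Prog
loopProg i j t = iter (rep (suc i) skipʳ) (rep (2 + i) skipˡ)
  ((rep (suc j) skipʳ ⨾ skipˡ ⨾ rep j delete₀ ⨾ rd ◂ (const false) done done ⨾ rep (suc i) skipˡ) ⨾ t)

entered-snoc : ∀ xs r → ones r ++ entered xs ≡ enc (xs ++ [ r ]) ʳ++ []
entered-snoc xs r = trans (sym (ones-ʳ++ r)) (leave xs r [])

length-snoc : ∀ (xs : List ℕ) {r} → length (xs ++ [ r ]) ≡ suc (length xs)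
length-snoc []       = refl
length-snoc (_ ∷ xs) = cong suc (length-snoc xs)

enc-snoc : ∀ xs r ys Q → enc (xs ++ [ r ]) ++ enc ys ++ Q ≡ enc (xs ++ r ∷ ys) ++ Q
enc-snoc xs r ys Q = trans (sym (++-assoc (enc (xs ++ [ r ])) _ Q))
  (cong (_++ Q) (trans (sym (enc-++ (xs ++ [ r ]) ys)) (cong enc (++-assoc xs [ r ] ys))))

back : ∀ xs r {Q} → Exec (rep (suc (length xs)) skipˡ) (ones r ++ entered xs , Q) ([] , enc (xs ++ [ r ]) ++ Q)
back xs r {Q} = subst₂ (λ n u → Exec (rep n skipˡ) (u , Q) ([] , enc (xs ++ [ r ]) ++ Q))
  (length-snoc xs) (sym (entered-snoc xs r)) (skipˡ-blocks (xs ++ [ r ]))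

loop-exit : ∀ {i j rs t τ} xs ys → length xs ≡ i → length ys ≡ j → rs ≡ xs ++ 0 ∷ ys → Home rs τ
          → ∃ λ τ′ → Exec (loopProg i j t) τ τ′ × Home rs τ′
loop-exit xs ys refl refl refl (m , refl) = _ ,
  iter₀ (enter xs 0 ys) (right (hd-enc ys (hd-zeros m))) (scan₀ left ⨾ back xs 0) ,
  proj₁ (restore ys m) ,
  cong ([] ,_) (trans (cong (enc (xs ++ [ 0 ]) ++_) (proj₂ (restore ys m))) (enc-snoc xs 0 ys _))
  where
  restore : ∀ ys m → ∃ λ m′ → false ∷ tl (enc ys ++ zeros m) ≡ enc ys ++ zeros m′
  restore []      m = suc (pred m) , cong (false ∷_) (tl-zeros m)
  restore (_ ∷ _) m = m , refl

-- The body and the remaining rounds are supplied as a continuation, because the tape they start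
-- from, with its number of blanks, is known only after the decrement.
loop-step : ∀ {i j rs rs′ t τ} {P : Tape → Set} xs r ys → length xs ≡ i → length ys ≡ j
          → rs ≡ xs ++ suc r ∷ ys → rs′ ≡ xs ++ r ∷ ys → Home rs τ
          → (∀ {τ₁} → Home rs′ τ₁ → ∃ λ τ₂ → Exec t τ₁ τ₂
               × ∃ λ τ₃ → Exec (loopProg i j t) τ₂ τ₃ × P τ₃)
          → ∃ λ τ₃ → Exec (loopProg i j t) τ τ₃ × P τ₃
loop-step {t = t} {P = P} xs r ys refl refl refl refl (m , refl) k =
  -- One of the two extra blanks is the cell that the sweep stepped onto at the end, the other is
  -- the cell freed by the decrement.
  finish (k (suc (suc (pred m)) , cong ([] ,_) eq))
  where
  Z = tl (zeros m)
  eq : enc (xs ++ [ r ]) ++ false ∷ encʳ ys ++ false ∷ Z ≡ enc (xs ++ r ∷ ys) ++ zeros (2 + pred m)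
  eq = trans (cong (enc (xs ++ [ r ]) ++_) (false∷encʳ ys))
    (trans (enc-snoc xs r ys _) (cong (λ u → enc (xs ++ r ∷ ys) ++ false ∷ false ∷ u) (tl-zeros m)))
  rearrange : (ones r ++ enc ys ++ [ false ]) ʳ++ (true ∷ entered xs)
            ≡ false ∷ enc ys ʳ++ (true ∷ ones r ++ entered xs)
  rearrange = begin
    (ones r ++ enc ys ++ [ false ]) ʳ++ (true ∷ entered xs)    ≡⟨ ++-ʳ++ (ones r) ⟩
    (enc ys ++ [ false ]) ʳ++ (ones (suc r) ʳ++ entered xs)    ≡⟨ ++-ʳ++ (enc ys) ⟩
    false ∷ enc ys ʳ++ (ones (suc r) ʳ++ entered xs)           ≡⟨ cong (λ u → false ∷ enc ys ʳ++ u) (ones-ʳ++ (suc r)) ⟩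
    false ∷ enc ys ʳ++ (true ∷ ones r ++ entered xs)           ∎
    where open ≡-Reasoning
  finish : _ → ∃ λ τ₃ → Exec (loopProg (length xs) (length ys) t) _ τ₃ × P τ₃
  finish (_ , e , _ , e′ , p) = _ ,
    iter₁ (enter xs (suc r) ys) (right refl)
      (( result-≡ (cong (_, Z) rearrange)
           (skipʳ-blocks ys r (hd-zeros m))
       ⨾ scan₀ left
       ⨾ delete₀-blocks ys
       ⨾ rd₁ left done
       ⨾ back xs r)
      ⨾ e) e′ , p

-- Register programs

Reg : Set
Reg = ℕ → ℕ

𝟙 : ℕ → Reg
𝟙 r i with i ≟ r
... | yes _ = 1
... | no  _ = 0

𝟙-same : ∀ r → 𝟙 r r ≡ 1
𝟙-same r with r ≟ r
... | yes _ = refl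
... | no ¬p = contradiction refl ¬p

𝟙-other : ∀ {r i} → i ≢ r → 𝟙 r i ≡ 0
𝟙-other {r} {i} ne with i ≟ r
... | yes p = contradiction p ne
... | no  _ = refl

infixl 6 _⊕_
infix 7 _·_
_·_ : ℕ → ℕ → Reg
(n · r) i = n * 𝟙 r i

_⊕_ : Reg → Reg → Reg
(ρ ⊕ σ) i = ρ i + σ i

·-other : ∀ n {r i} → i ≢ r → (n · r) i ≡ 0
·-other n ne = trans (cong (n *_) (𝟙-other ne)) (*-zeroʳ n)

·-same : ∀ n r → (n · r) r ≡ n
·-same n r = trans (cong (n *_) (𝟙-same r)) (*-identityʳ n)

-- loop r c stands for: while register r is nonzero, decrement it and do c.
data Cmd : Set where
  skip : Cmd
  inc  : ℕ → Cmd
  _⨾_  : Cmd → Cmd → Cmd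
  loop : ℕ → Cmd → Cmd

infix 4 _⊢_⇒_

-- Register contents are functions compared pointwise, and `conv` takes the place of extensionality.
-- In `loop₁` a state with nonzero `r` is written as a sum, which avoids truncated subtraction.
data _⊢_⇒_ : Cmd → Reg → Reg → Set where
  conv  : ∀ {c ρ ρ′ σ σ′} → ρ ≗ ρ′ → c ⊢ ρ′ ⇒ σ′ → σ′ ≗ σ → c ⊢ ρ ⇒ σ
  skip  : ∀ {ρ} → skip ⊢ ρ ⇒ ρ
  inc   : ∀ {r ρ} → inc r ⊢ ρ ⇒ ρ ⊕ 1 · r
  _⨾_   : ∀ {c d ρ σ υ} → c ⊢ ρ ⇒ σ → d ⊢ σ ⇒ υ → (c ⨾ d) ⊢ ρ ⇒ υ
  loop₀ : ∀ {r c ρ} → ρ r ≡ 0 → loop r c ⊢ ρ ⇒ ρ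
  loop₁ : ∀ {r c ρ σ υ} → c ⊢ ρ ⇒ σ → loop r c ⊢ σ ⇒ υ → loop r c ⊢ ρ ⊕ 1 · r ⇒ υ

width : Cmd → ℕ
width skip       = 0
width (inc r)    = suc r
width (c ⨾ d)    = width c ⊔ width d
width (loop r c) = suc r ⊔ width c

regs : ℕ → Reg → List ℕ
regs k ρ = applyUpTo ρ k

regs-cong : ∀ k {ρ σ} → (∀ i → i < k → ρ i ≡ σ i) → regs k ρ ≡ regs k σ
regs-cong zero    h = refl
regs-cong (suc k) h = cong₂ _∷_ (h 0 z<s) (regs-cong k (λ i p → h (suc i) (s<s p)))

regs-split : ∀ {j k} ρ → j < k
           → regs k ρ ≡ regs j ρ ++ ρ j ∷ regs (k ∸ suc j) (λ i → ρ (suc j + i))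
regs-split {zero}  {suc k} ρ _         = refl
regs-split {suc j} {suc k} ρ (s≤s j<k) = cong (ρ 0 ∷_) (regs-split (ρ ∘ suc) j<k)

regs-bump : ∀ {j k} ρ → j < k → regs k (ρ ⊕ 1 · j)
          ≡ regs j ρ ++ suc (ρ j) ∷ regs (k ∸ suc j) (λ i → ρ (suc j + i))
regs-bump {j} {k} ρ j<k = begin
  regs k (ρ ⊕ 1 · j)
    ≡⟨ regs-split (ρ ⊕ 1 · j) j<k ⟩
  regs j (ρ ⊕ 1 · j) ++ (ρ ⊕ 1 · j) j ∷ regs (k ∸ suc j) (λ i → (ρ ⊕ 1 · j) (suc j + i))
    ≡⟨ cong₂ _++_ (regs-cong j (λ i i<j → same i (<⇒≢ i<j)))
         (cong₂ _∷_ (trans (cong (ρ j +_) (·-same 1 j)) (+-comm (ρ j) 1))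
           (regs-cong (k ∸ suc j) (λ i _ → same (suc j + i) (<⇒≢ (s≤s (m≤m+n j i)) ∘ sym)))) ⟩
  regs j ρ ++ suc (ρ j) ∷ regs (k ∸ suc j) (λ i → ρ (suc j + i)) ∎
  where
  open ≡-Reasoning
  same : ∀ i → i ≢ j → (ρ ⊕ 1 · j) i ≡ ρ i
  same i ne = trans (cong (ρ i +_) (·-other 1 ne)) (+-identityʳ (ρ i))

toProg : ℕ → Cmd → Prog
toProg k skip       = done
toProg k (inc r)    = incProg r (k ∸ suc r)
toProg k (c ⨾ d)    = toProg k c ⨾ toProg k d
toProg k (loop r c) = loopProg r (k ∸ suc r) (toProg k c)

toProg-correct : ∀ {k c ρ σ τ} → width c ≤ k → c ⊢ ρ ⇒ σ → Home (regs k ρ) τ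
               → ∃ λ τ′ → Exec (toProg k c) τ τ′ × Home (regs k σ) τ′
toProg-correct {k} w (conv p e q) h
  with toProg-correct w e (subst (λ u → Home u _) (regs-cong k (λ i _ → p i)) h)
... | _ , ex , h′ = _ , ex , subst (λ u → Home u _) (regs-cong k (λ i _ → q i)) h′
toProg-correct w skip h = _ , done , h
toProg-correct {k} w (inc {r} {ρ}) h =
  inc-correct (regs r ρ) (ρ r) _ (length-applyUpTo ρ r) (length-applyUpTo _ (k ∸ suc r))
    (regs-split ρ w) (regs-bump ρ w) h
toProg-correct {k} w (_⨾_ {c} {d} p q) h
  with toProg-correct (≤-trans (m≤m⊔n (width c) (width d)) w) p h
... | _ , ex , h′ with toProg-correct (≤-trans (m≤n⊔m (width c) (width d)) w) q h′
... | _ , ex′ , h″ = _ , ex ⨾ ex′ , h″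
toProg-correct {k} w (loop₀ {r} {c} {ρ} z) h =
  loop-exit (regs r ρ) _ (length-applyUpTo ρ r) (length-applyUpTo _ (k ∸ suc r))
    (trans (regs-split ρ (≤-trans (m≤m⊔n (suc r) (width c)) w))
      (cong (λ u → regs r ρ ++ u ∷ regs (k ∸ suc r) (λ i → ρ (suc r + i))) z)) h
toProg-correct {k} {σ = υ} w (loop₁ {r} {c} {ρ} p q) h =
  loop-step {P = Home (regs k υ)} (regs r ρ) (ρ r) _ (length-applyUpTo ρ r)
    (length-applyUpTo _ (k ∸ suc r)) (regs-bump ρ r<k) (regs-split ρ r<k) h continue
  where
  r<k = ≤-trans (m≤m⊔n (suc r) (width c)) w
  continue : ∀ {τ₁} → Home (regs k ρ) τ₁ → ∃ λ τ₂ → Exec (toProg k c) τ₁ τ₂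
           × ∃ λ τ₃ → Exec (toProg k (loop r c)) τ₂ τ₃ × Home (regs k υ) τ₃
  continue h₁ with toProg-correct (≤-trans (m≤n⊔m (suc r) (width c)) w) p h₁
  ... | τ₂ , ex , h₂ = τ₂ , ex , toProg-correct w q h₂

-- Recursive functions as register programs

-- The body leaves `r` alone, so there are exactly `n` rounds, each adding `d`. Clearing,
-- transferring and copying are instances.
drain : ∀ {r c ρ} d → (∀ {σ} → c ⊢ σ ⇒ σ ⊕ d) → d r ≡ 0 → ρ r ≡ 0
      → ∀ n → loop r c ⊢ ρ ⊕ n · r ⇒ (λ i → ρ i + n * d i)
drain {r} d body d0 ρ0 zero    = conv (λ _ → refl) (loop₀ (trans (+-identityʳ _) ρ0)) (λ _ → refl)
drain {r} {ρ = ρ} d body d0 ρ0 (suc n) =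
  conv (λ i → eq₁ (ρ i) n (𝟙 r i))
    (loop₁ body (conv (λ i → eq₂ (ρ i) n (𝟙 r i) (d i))
      (drain {ρ = ρ ⊕ d} d body d0 (cong₂ _+_ ρ0 d0) n)
      (λ i → +-assoc (ρ i) (d i) _)))
    (λ _ → refl)
  where
  eq₁ : ∀ x n e → x + suc n * e ≡ (x + n * e) + 1 * e
  eq₁ = solve-∀
  eq₂ : ∀ x n e d → x + n * e + d ≡ x + d + n * e
  eq₂ = solve-∀

clear : ℕ → Cmd
clear r = loop r skip

transfer : ℕ → ℕ → Cmd
transfer r o = loop r (inc o)

-- Reading a register by a loop empties it, hence the second copy in `t`, from which `a` is
-- restored.
copy : ℕ → ℕ → ℕ → Cmd
copy a o t = loop a (inc o ⨾ inc t) ⨾ transfer t a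

clear-correct : ∀ {r ρ} → ρ r ≡ 0 → ∀ n → clear r ⊢ ρ ⊕ n · r ⇒ ρ
clear-correct {ρ = ρ} z n = conv (λ _ → refl)
  (drain (const 0) (conv (λ _ → refl) skip (λ i → sym (+-identityʳ _))) refl z n)
  (λ i → trans (cong (ρ i +_) (*-zeroʳ n)) (+-identityʳ _))

transfer-correct : ∀ {r o ρ} → r ≢ o → ρ r ≡ 0 → ∀ n → transfer r o ⊢ ρ ⊕ n · r ⇒ ρ ⊕ n · o
transfer-correct {o = o} {ρ} ne z n = conv (λ _ → refl) (drain (1 · o) inc (·-other 1 ne) z n)
  (λ i → cong (λ u → ρ i + n * u) (*-identityˡ (𝟙 o i)))

reset : ℕ → Reg → Reg
reset a ρ i with i ≟ a
... | yes _ = 0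
... | no  _ = ρ i

reset-≗ : ∀ a ρ → ρ ≗ reset a ρ ⊕ ρ a · a
reset-≗ a ρ i with i ≟ a
... | yes refl = sym (*-identityʳ (ρ a))
... | no  _    = sym (trans (cong (ρ i +_) (*-zeroʳ (ρ a))) (+-identityʳ _))

reset-same : ∀ a ρ → reset a ρ a ≡ 0
reset-same a ρ with a ≟ a
... | yes _ = refl
... | no ¬p = contradiction refl ¬p

reset-0 : ∀ a ρ {i} → ρ i ≡ 0 → reset a ρ i ≡ 0
reset-0 a ρ {i} z with i ≟ a
... | yes _ = refl
... | no  _ = z

⊕-0 : ∀ {ρ σ : Reg} {i} → ρ i ≡ 0 → σ i ≡ 0 → (ρ ⊕ σ) i ≡ 0
⊕-0 = cong₂ _+_

copy-correct : ∀ {a o t ρ} → a ≢ o → a ≢ t → t ≢ o → ρ t ≡ 0 → copy a o t ⊢ ρ ⇒ ρ ⊕ ρ a · o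
copy-correct {a} {o} {t} {ρ} a≢o a≢t t≢o z =
  conv (reset-≗ a ρ)
    ( conv (λ _ → refl)
        (drain (1 · o ⊕ 1 · t)
          (λ {σ} → conv (λ _ → refl) (inc ⨾ inc) (λ i → +-assoc (σ i) _ _))
          (⊕-0 {1 · o} {1 · t} (·-other 1 a≢o) (·-other 1 a≢t)) (reset-same a ρ) n)
        (λ i → eq₁ (ρ₀ i) n (𝟙 o i) (𝟙 t i))
    ⨾ transfer-correct {ρ = ρ₀ ⊕ n · o} (a≢t ∘ sym)
        (⊕-0 {ρ₀} {n · o} (reset-0 a ρ z) (·-other n t≢o)) n)
    (λ i → trans (eq₂ (ρ₀ i) n (𝟙 o i) (𝟙 a i)) (cong (_+ n * 𝟙 o i) (sym (reset-≗ a ρ i))))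
  where
  n = ρ a
  ρ₀ = reset a ρ
  eq₁ : ∀ x n p q → x + n * (1 * p + 1 * q) ≡ x + n * p + n * q
  eq₁ = solve-∀
  eq₂ : ∀ x n p q → x + n * p + n * q ≡ x + n * q + n * p
  eq₂ = solve-∀

range : ℕ → (m : ℕ) → Vec ℕ m
range t zero    = []
range t (suc m) = t ∷ range (suc t) m

clears : ℕ → ℕ → Cmd
clears t zero    = skip
clears t (suc m) = clear t ⨾ clears (suc t) m

-- The value is added to register o. The registers from b on are scratch and are returned to 0.
mutual
  compile : ∀ {n} → PR n → Vec ℕ n → ℕ → ℕ → Cmd
  compile zer         as       o b = skip
  compile succ        (a ∷ []) o b = copy a o b ⨾ inc o
  compile (proj i)    as       o b = copy (lookup as i) o b
  compile (comp {m} f gs) as   o b =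
    compile* gs as b (b + m) ⨾ compile f (range b m) o (b + m) ⨾ clears b m
  -- Register `b` counts the rounds left and `1 + b` the rounds done; `2 + b` holds the value so far
  -- and `3 + b` the next value.
  compile (prec g h)  (x ∷ as) o b =
    copy x b (1 + b) ⨾ (compile g as (2 + b) (4 + b) ⨾ precLoop h as b)
    ⨾ transfer (2 + b) o ⨾ clear (1 + b)
  -- Register `b` holds the candidate and `1 + b` the value of `f` at it, which is what the loop
  -- tests. A round begins by clearing the test, since the loop itself takes only 1 off it.
  compile (mu f)      as       o b =
    compile f (b ∷ as) (1 + b) (2 + b) ⨾ muLoop f as b ⨾ transfer b o

  compile* : ∀ {m n} → Vec (PR n) m → Vec ℕ n → ℕ → ℕ → Cmd
  compile* []       as t s = skip
  compile* (g ∷ gs) as t s = compile g as t s ⨾ compile* gs as (suc t) s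

  precLoop : ∀ {n} → PR (2 + n) → Vec ℕ n → ℕ → Cmd
  precLoop h as b = loop b
    ( compile h (1 + b ∷ 2 + b ∷ as) (3 + b) (4 + b)
    ⨾ clear (2 + b) ⨾ transfer (3 + b) (2 + b) ⨾ inc (1 + b))

  muLoop : ∀ {n} → PR (suc n) → Vec ℕ n → ℕ → Cmd
  muLoop f as b = loop (1 + b) (clear (1 + b) ⨾ inc b ⨾ compile f (b ∷ as) (1 + b) (2 + b))

Zero : ℕ → Reg → Set
Zero b ρ = ∀ {i} → b ≤ i → ρ i ≡ 0

Zero-⊕ : ∀ {b ρ σ} → Zero b ρ → Zero b σ → Zero b (ρ ⊕ σ)
Zero-⊕ {ρ = ρ} {σ} p q {i} l = ⊕-0 {ρ} {σ} {i} (p l) (q l)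

Zero-· : ∀ {b r} n → r < b → Zero b (n · r)
Zero-· n r<b b≤i = ·-other n (>⇒≢ (<-≤-trans r<b b≤i))

Zero-mono : ∀ {b c ρ} → b ≤ c → Zero b ρ → Zero c ρ
Zero-mono b≤c z l = z (≤-trans b≤c l)

map-⊕ : ∀ {n b} ρ σ {as : Vec ℕ n} → (∀ {i} → i < b → σ i ≡ 0) → VecAll.All (_< b) as
      → Vec.map (ρ ⊕ σ) as ≡ Vec.map ρ as
map-⊕ ρ σ z []             = refl
map-⊕ ρ σ z (_∷_ {x = a} p ps) =
  cong₂ _∷_ (trans (cong (ρ a +_) (z p)) (+-identityʳ _)) (map-⊕ ρ σ z ps)

spread : ∀ {m} → ℕ → Vec ℕ m → Reg
spread t []       = const 0
spread t (y ∷ ys) = y · t ⊕ spread (suc t) ys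

spread-low : ∀ {m} t (ys : Vec ℕ m) {i} → i < t → spread t ys i ≡ 0
spread-low t []       l = refl
spread-low t (y ∷ ys) {i} l =
  ⊕-0 {y · t} {spread (suc t) ys} (·-other y (<⇒≢ l)) (spread-low (suc t) ys (m≤n⇒m≤1+n l))

spread-high : ∀ {m} t (ys : Vec ℕ m) → Zero (t + m) (spread t ys)
spread-high t []       l = refl
spread-high {suc m} t (y ∷ ys) {i} l =
  ⊕-0 {y · t} {spread (suc t) ys} (·-other y (>⇒≢ (≤-trans (s≤s (m≤m+n t m)) l′)))
    (spread-high (suc t) ys l′)
  where l′ = subst (_≤ i) (+-suc t m) l

spread-lookup : ∀ {m} t (ys : Vec ℕ m) {σ} → (∀ {i} → t ≤ i → σ i ≡ spread t ys i)
              → Vec.map σ (range t m) ≡ ys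
spread-lookup t []       h = refl
spread-lookup t (y ∷ ys) h = cong₂ _∷_
  (trans (h ≤-refl) (trans (cong₂ _+_ (·-same y t) (spread-low (suc t) ys ≤-refl)) (+-identityʳ y)))
  (spread-lookup (suc t) ys (λ {i} l → trans (h (<⇒≤ l)) (cong (_+ spread (suc t) ys i) (·-other y (>⇒≢ l)))))

clears-correct : ∀ {m ρ} t (ys : Vec ℕ m) → Zero t ρ → clears t m ⊢ ρ ⊕ spread t ys ⇒ ρ
clears-correct t []       z = conv (λ i → +-identityʳ _) skip (λ _ → refl)
clears-correct {ρ = ρ} t (y ∷ ys) z =
  conv (λ i → eq (ρ i) (y * 𝟙 t i) (spread (suc t) ys i))
    (clear-correct {ρ = ρ ⊕ spread (suc t) ys}
       (⊕-0 {ρ} {spread (suc t) ys} (z ≤-refl) (spread-low (suc t) ys ≤-refl)) y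
     ⨾ clears-correct (suc t) ys (Zero-mono {ρ = ρ} (n≤1+n t) z))
    (λ _ → refl)
  where
  eq : ∀ x p q → x + (p + q) ≡ x + q + p
  eq = solve-∀

range-< : ∀ t m → VecAll.All (_< t + m) (range t m)
range-< t zero    = []
range-< t (suc m) = subst (λ u → VecAll.All (_< u) (range t (suc m))) (sym (+-suc t m))
  (s≤s (m≤m+n t m) ∷ range-< (suc t) m)

range-≥ : ∀ t m → VecAll.All (t ≤_) (range t m)
range-≥ t zero    = []
range-≥ t (suc m) = ≤-refl ∷ VecAll.map <⇒≤ (range-≥ (suc t) m)

Compiled : ∀ {n} → PR n → Set
Compiled {n} f = ∀ {as : Vec ℕ n} {o b ρ xs y}
               → VecAll.All (_< b) as → VecAll.All (_≢ o) as → o < b → Zero b ρ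
               → Vec.map ρ as ≡ xs → f ⟦ xs ⟧⇓ y → compile f as o b ⊢ ρ ⇒ ρ ⊕ y · o

module _ {n} {as : Vec ℕ n} {b : ℕ} (lt : VecAll.All (_< b) as) where

  <⇒apart : ∀ {o} → b ≤ o → VecAll.All (_≢ o) as
  <⇒apart b≤o = VecAll.map (λ a<b → <⇒≢ (<-≤-trans a<b b≤o)) lt

  weaken : ∀ {c} → b ≤ c → VecAll.All (_< c) as
  weaken b≤c = VecAll.map (λ a<b → <-≤-trans a<b b≤c) lt

  compile-prec : ∀ {g h o ρ x xs y} → Compiled g → Compiled h → x < b → x ≢ o → VecAll.All (_≢ o) as
               → o < b → Zero b ρ → ρ x ∷ Vec.map ρ as ≡ xs → prec g h ⟦ xs ⟧⇓ y
               → compile (prec g h) (x ∷ as) o b ⊢ ρ ⇒ ρ ⊕ y · o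
  compile-prec {g} {h} {o} {ρ} {x} {y = y} G H x<b x≢o apart o<b z refl ev =
      copy-correct {ρ = ρ} (<⇒≢ x<b) (<⇒≢ (m≤n⇒m≤1+n x<b)) 1+n≢n (z (n≤1+n b))
    ⨾ conv (λ i → eq₁ (ρ i) (ρ x) (𝟙 b i) (𝟙 (1 + b) i) (𝟙 (2 + b) i)) (iterate ev 0 (loop₀ at-b))
        (λ i → eq₂ (ρ i) (ρ x) y (𝟙 b i) (𝟙 (1 + b) i) (𝟙 (2 + b) i))
    ⨾ transfer-correct {ρ = ρ ⊕ ρ x · (1 + b)} (>⇒≢ (m≤n⇒m≤1+n (m≤n⇒m≤1+n o<b)))
        (⊕-0 {ρ} {ρ x · (1 + b)} (z (m≤n+m b 2)) (·-other (ρ x) 1+n≢n)) y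
    ⨾ conv (λ i → eq₃ (ρ i) (ρ x * 𝟙 (1 + b) i) (y * 𝟙 o i))
        (clear-correct {ρ = ρ ⊕ y · o}
          (⊕-0 {ρ} {y · o} (z (n≤1+n b)) (·-other y (>⇒≢ (m≤n⇒m≤1+n o<b)))) (ρ x))
        (λ _ → refl)
    where
    st : ℕ → ℕ → ℕ → Reg
    st rem cnt v = ρ ⊕ (rem · b ⊕ cnt · (1 + b) ⊕ v · (2 + b))
    eq₁ : ∀ p x q r s → p + x * q ≡ p + ((x + 0) * q + 0 * r + 0 * s)
    eq₁ = solve-∀
    eq₂ : ∀ p x y q r s → p + (0 * q + x * r + y * s) ≡ p + x * r + y * s
    eq₂ = solve-∀
    eq₃ : ∀ p q r → p + q + r ≡ p + r + q
    eq₃ = solve-∀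
    b<2+b = s≤s (n≤1+n b)
    delta-low : ∀ rem cnt v {i} → i < b → (rem · b ⊕ cnt · (1 + b) ⊕ v · (2 + b)) i ≡ 0
    delta-low rem cnt v i<b = cong₂ _+_ (cong₂ _+_ (·-other rem (<⇒≢ i<b))
      (·-other cnt (<⇒≢ (m≤n⇒m≤1+n i<b)))) (·-other v (<⇒≢ (m≤n⇒m≤1+n (m≤n⇒m≤1+n i<b))))
    st-high : ∀ rem cnt v → Zero (3 + b) (st rem cnt v)
    st-high rem cnt v = Zero-⊕ {ρ = ρ} {rem · b ⊕ cnt · (1 + b) ⊕ v · (2 + b)}
      (Zero-mono {ρ = ρ} (m≤n+m b 3) z)
      (Zero-⊕ {ρ = rem · b ⊕ cnt · (1 + b)} {v · (2 + b)}
        (Zero-⊕ {ρ = rem · b} {cnt · (1 + b)} (Zero-· rem (s≤s (m≤n+m b 2))) (Zero-· cnt (n≤1+n (2 + b))))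
        (Zero-· v ≤-refl))
    st-as : ∀ rem cnt v → Vec.map (st rem cnt v) as ≡ Vec.map ρ as
    st-as rem cnt v = map-⊕ ρ _ (delta-low rem cnt v) lt
    st-cnt : ∀ rem cnt v → st rem cnt v (1 + b) ≡ cnt
    st-cnt rem cnt v = trans (cong₂ _+_ (z (n≤1+n b)) (cong₂ _+_ (cong₂ _+_ (·-other rem 1+n≢n)
      (·-same cnt (1 + b))) (·-other v (1+n≢n ∘ sym)))) (+-identityʳ cnt)
    st-val : ∀ rem cnt v → st rem cnt v (2 + b) ≡ v
    st-val rem cnt v = cong₂ _+_ (z (m≤n+m b 2)) (cong₂ _+_ (cong₂ _+_ (·-other rem (>⇒≢ b<2+b))
      (·-other cnt 1+n≢n)) (·-same v (2 + b)))
    at-b : st 0 (ρ x) y b ≡ 0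
    at-b = cong₂ _+_ (z ≤-refl) (cong₂ _+_ (·-other (ρ x) (1+n≢n ∘ sym)) (·-other y (<⇒≢ b<2+b)))
    body : ∀ {d x r y} → h ⟦ x ∷ r ∷ Vec.map ρ as ⟧⇓ y →
      (compile h (1 + b ∷ 2 + b ∷ as) (3 + b) (4 + b) ⨾ clear (2 + b) ⨾ transfer (3 + b) (2 + b) ⨾ inc (1 + b))
        ⊢ st d x r ⇒ st d (suc x) y
    body {d} {x} {r} {y} e =
        H {ρ = st d x r} (s≤s (m≤n+m (1 + b) 2) ∷ s≤s (m≤n+m (2 + b) 1) ∷ weaken (m≤n+m b 4))
          (<⇒≢ (s≤s (n≤1+n (1 + b))) ∷ <⇒≢ ≤-refl ∷ <⇒apart (m≤n+m b 3)) ≤-refl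
          (Zero-mono {ρ = st d x r} (n≤1+n (3 + b)) (st-high d x r))
          (cong₂ _∷_ (st-cnt d x r) (cong₂ _∷_ (st-val d x r) (st-as d x r))) e
      ⨾ conv (λ i → b₁ (ρ i) (d * 𝟙 b i) (x * 𝟙 (1 + b) i) (r * 𝟙 (2 + b) i) (y * 𝟙 (3 + b) i) (𝟙 (2 + b) i))
          (clear-correct {ρ = st d x 0 ⊕ y · (3 + b)}
            (⊕-0 {st d x 0} {y · (3 + b)} (st-val d x 0) (·-other y (1+n≢n ∘ sym))) r)
          (λ _ → refl)
      ⨾ transfer-correct {ρ = st d x 0} 1+n≢n (st-high d x 0 ≤-refl) y
      ⨾ conv (λ _ → refl) inc
          (λ i → b₂ (ρ i) (d * 𝟙 b i) x (𝟙 (1 + b) i) y (𝟙 (2 + b) i))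
      where
      b₁ : ∀ p q r s t u → p + (q + r + s) + t ≡ p + (q + r + 0 * u) + t + s
      b₁ = solve-∀
      b₂ : ∀ p q x r y s → p + (q + x * r + 0 * s) + y * s + 1 * r ≡ p + (q + suc x * r + y * s)
      b₂ = solve-∀
    -- A derivation for `prec` ends with the last round, whereas `loop₁` splits off the first round
    -- of those that remain. The continuation reconciles the two orders: the rounds after the first
    -- `x`, of which `d` are still counted in register `b`, come from `k`.
    iterate : ∀ {x y} → prec g h ⟦ x ∷ Vec.map ρ as ⟧⇓ y → ∀ d {υ} → precLoop h as b ⊢ st d x y ⇒ υ
            → (compile g as (2 + b) (4 + b) ⨾ precLoop h as b) ⊢ st (x + d) 0 0 ⇒ υ
    iterate {y = y} (ev-prec0 e) d k =
        conv (λ _ → refl)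
          (G {ρ = st d 0 0} (weaken (m≤n+m b 4)) (<⇒apart (m≤n+m b 2)) (n≤1+n (3 + b))
            (Zero-mono {ρ = st d 0 0} (n≤1+n (3 + b)) (st-high d 0 0)) (st-as d 0 0) e)
          (λ i → e₁ (ρ i) (d * 𝟙 b i) (𝟙 (1 + b) i) y (𝟙 (2 + b) i))
      ⨾ k
      where
      e₁ : ∀ p q r y s → p + (q + 0 * r + 0 * s) + y * s ≡ p + (q + 0 * r + y * s)
      e₁ = solve-∀
    iterate (ev-precS {x = x} {r = r} e e′) d k =
      conv (λ i → cong (λ u → st u 0 0 i) (sym (+-suc x d)))
        (iterate e (suc d)
          (conv (λ i → e₁ (ρ i) d (𝟙 b i) (x * 𝟙 (1 + b) i) (r * 𝟙 (2 + b) i))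
            (loop₁ (body {d} e′) k) (λ _ → refl)))
        (λ _ → refl)
      where
      e₁ : ∀ p d q r s → p + (suc d * q + r + s) ≡ p + (d * q + r + s) + 1 * q
      e₁ = solve-∀

  compile-mu : ∀ {f o ρ xs y} → Compiled f → VecAll.All (_≢ o) as → o < b → Zero b ρ
             → Vec.map ρ as ≡ xs → mu f ⟦ xs ⟧⇓ y → compile (mu f) as o b ⊢ ρ ⇒ ρ ⊕ y · o
  compile-mu {f} {o} {ρ} {y = y} F apart o<b z refl (ev-mu e below) with search y 0 refl
    where
    st : ℕ → ℕ → Reg
    st z t = ρ ⊕ (z · b ⊕ t · (1 + b))
    st-high : ∀ x t → Zero (2 + b) (st x t)
    st-high x t = Zero-⊕ {ρ = ρ} {x · b ⊕ t · (1 + b)} (Zero-mono {ρ = ρ} (m≤n+m b 2) z)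
      (Zero-⊕ {ρ = x · b} {t · (1 + b)} (Zero-· x (s≤s (n≤1+n b))) (Zero-· t ≤-refl))
    st-args : ∀ x → Vec.map (st x 0) (b ∷ as) ≡ x ∷ Vec.map ρ as
    st-args x = cong₂ _∷_
      (trans (cong₂ _+_ (z ≤-refl) (cong (_+ 0) (·-same x b))) (+-identityʳ x))
      (map-⊕ ρ _ (λ i<b → cong (_+ 0) (·-other x (<⇒≢ i<b))) lt)
    st-test : ∀ x → st x 0 (1 + b) ≡ 0
    st-test x = cong₂ _+_ (z (n≤1+n b)) (cong (_+ 0) (·-other x 1+n≢n))
    eval : ∀ {x t} → f ⟦ x ∷ Vec.map ρ as ⟧⇓ t → compile f (b ∷ as) (1 + b) (2 + b) ⊢ st x 0 ⇒ st x t
    eval {x} {t} e = conv (λ _ → refl)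
      (F {ρ = st x 0} (s≤s (n≤1+n b) ∷ weaken (m≤n+m b 2)) (<⇒≢ ≤-refl ∷ <⇒apart (n≤1+n b)) ≤-refl
        (st-high x 0) (st-args x) e)
      (λ i → e₁ (ρ i) (x * 𝟙 b i) t (𝟙 (1 + b) i))
      where
      e₁ : ∀ p q t s → p + (q + 0 * s) + t * s ≡ p + (q + t * s)
      e₁ = solve-∀
    -- Induction on the distance from the candidate `x` to the minimum `y`. The test register must
    -- already hold the value at `x` when the loop is entered, so the evaluation and the loop are
    -- returned separately.
    search : ∀ d x → x + d ≡ y → ∃ λ t → compile f (b ∷ as) (1 + b) (2 + b) ⊢ st x 0 ⇒ st x t
                                       × muLoop f as b ⊢ st x t ⇒ st y 0
    search zero x eq with trans (sym (+-identityʳ x)) eq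
    ... | refl = 0 , eval e , loop₀ (st-test x)
    search (suc d) x eq
      with below x (subst (x <_) eq (m<m+n x z<s)) | search d (suc x) (trans (sym (+-suc x d)) eq)
    ... | r , e′ | t , first , rest = suc r , eval e′ ,
      conv (λ i → e₁ (ρ i) (x * 𝟙 b i) r (𝟙 (1 + b) i))
        (loop₁
          ( conv (λ i → e₂ (ρ i) (x * 𝟙 b i) r (𝟙 (1 + b) i))
              (clear-correct {ρ = st x 0} (st-test x) r) (λ _ → refl)
          ⨾ conv (λ _ → refl) inc (λ i → e₃ (ρ i) x (𝟙 b i) (𝟙 (1 + b) i))
          ⨾ first) rest)
        (λ _ → refl)
      where
      e₁ : ∀ p q r s → p + (q + suc r * s) ≡ p + (q + r * s) + 1 * s
      e₁ = solve-∀
      e₂ : ∀ p q r s → p + (q + r * s) ≡ p + (q + 0 * s) + r * s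
      e₂ = solve-∀
      e₃ : ∀ p x q s → p + (x * q + 0 * s) + 1 * q ≡ p + (suc x * q + 0 * s)
      e₃ = solve-∀
  ... | t , first , rest =
      conv (λ i → sym (+-identityʳ (ρ i))) first (λ _ → refl)
    ⨾ rest
    ⨾ conv (λ i → cong (ρ i +_) (+-identityʳ _)) (transfer-correct (>⇒≢ o<b) (z ≤-refl) y) (λ _ → refl)

mutual
  compile-correct : ∀ {n} (f : PR n) → Compiled f
  compile-correct zer lt apart o<b z eq ev-zer = conv (λ i → sym (+-identityʳ _)) skip (λ _ → refl)
  compile-correct succ {a ∷ []} {o} {b} {ρ} (a<b ∷ []) (a≢o ∷ []) o<b z refl ev-succ =
    conv (λ _ → refl)
      (copy-correct {ρ = ρ} a≢o (<⇒≢ a<b) (>⇒≢ o<b) (z ≤-refl) ⨾ inc)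
      (λ i → eq (ρ i) (ρ a) (𝟙 o i))
    where
    eq : ∀ p x q → p + x * q + 1 * q ≡ p + suc x * q
    eq = solve-∀
  compile-correct (proj i) {as} {o} {b} {ρ} lt apart o<b z refl (ev-proj .i) =
    conv (λ _ → refl)
      (copy-correct {ρ = ρ} (VecAll.lookup apart (∈-lookup i as))
        (<⇒≢ (VecAll.lookup lt (∈-lookup i as))) (>⇒≢ o<b) (z ≤-refl))
      (λ j → cong (λ u → ρ j + u * 𝟙 o j) (sym (lookup-map i ρ as)))
  compile-correct (comp {m} f gs) {as} {o} {b} {ρ} lt apart o<b z eq (ev-comp {ys = ys} {y} es e) =
      compile*-correct gs {s = b + m} lt ≤-refl (Zero-mono {ρ = ρ} (m≤m+n b m) z) eq es
    ⨾ compile-correct f {ρ = ρ ⊕ spread b ys} (range-< b m)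
        (VecAll.map (λ b≤i → >⇒≢ (<-≤-trans o<b b≤i)) (range-≥ b m)) (<-≤-trans o<b (m≤m+n b m))
        (Zero-⊕ {ρ = ρ} {spread b ys} (Zero-mono {ρ = ρ} (m≤m+n b m) z) (spread-high b ys))
        (spread-lookup b ys (λ {i} l → cong (_+ spread b ys i) (z l))) e
    ⨾ conv (λ i → e₁ (ρ i) (spread b ys i) (y * 𝟙 o i))
        (clears-correct {ρ = ρ ⊕ y · o} b ys (Zero-⊕ {ρ = ρ} {y · o} z (Zero-· y o<b)))
        (λ _ → refl)
    where
    e₁ : ∀ p q r → p + q + r ≡ p + r + q
    e₁ = solve-∀
  compile-correct (prec g h) {x ∷ as} (x<b ∷ lt) (x≢o ∷ apart) =
    compile-prec lt (compile-correct g) (compile-correct h) x<b x≢o apart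
  compile-correct (mu f) lt apart = compile-mu lt (compile-correct f) apart

  compile*-correct : ∀ {m n} (gs : Vec (PR n) m) {as : Vec ℕ n} {t s ρ xs ys}
                   → VecAll.All (_< t) as → t + m ≤ s → Zero s ρ → Vec.map ρ as ≡ xs → gs ⟦ xs ⟧⇓* ys
                   → compile* gs as t s ⊢ ρ ⇒ ρ ⊕ spread t ys
  compile*-correct [] lt le z eq ev-[] = conv (λ i → sym (+-identityʳ _)) skip (λ _ → refl)
  compile*-correct {suc m} (g ∷ gs) {as} {t} {s} {ρ} lt le z eq (ev-∷ {y = y} {ys = ys} e es) =
    conv (λ _ → refl)
      ( compile-correct g (weaken lt (<⇒≤ t<s)) (<⇒apart lt ≤-refl) t<s z eq e
      ⨾ compile*-correct gs {ρ = ρ ⊕ y · t} (weaken lt (n≤1+n t)) (subst (_≤ s) (+-suc t m) le)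
          (Zero-⊕ {ρ = ρ} {y · t} z (Zero-· y t<s))
          (trans (map-⊕ ρ (y · t) (λ i<t → ·-other y (<⇒≢ i<t)) lt) eq) es)
      (λ i → +-assoc (ρ i) _ _)
    where
    t<s : t < s
    t<s = ≤-trans (s≤s (m≤m+n t m)) (subst (_≤ s) (+-suc t m) le)

-- The code of an instance as a recursive function

Computable : ∀ {n} → (Vec ℕ n → ℕ) → Set
Computable {n} F = Σ (PR n) λ f → ∀ xs → f ⟦ xs ⟧⇓ F xs

private variable
  n : ℕ
  F G : Vec ℕ n → ℕ

argᶜ : ∀ i → Computable {n} (λ xs → lookup xs i)
argᶜ i = proj i , λ _ → ev-proj i

constᶜ : ∀ c → Computable {n} (λ _ → c)
constᶜ zero    = zer , λ _ → ev-zer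
constᶜ (suc c) = comp succ (proj₁ (constᶜ c) ∷ []) , λ xs → ev-comp (ev-∷ (proj₂ (constᶜ c) xs) ev-[]) ev-succ

sucᶜ : Computable F → Computable (λ xs → suc (F xs))
sucᶜ (f , e) = comp succ (f ∷ []) , λ xs → ev-comp (ev-∷ (e xs) ev-[]) ev-succ

comp₁ᶜ : {H : Vec ℕ 1 → ℕ} → Computable H → Computable F → Computable (λ xs → H (F xs ∷ []))
comp₁ᶜ (h , eh) (f , ef) = comp h (f ∷ []) , λ xs → ev-comp (ev-∷ (ef xs) ev-[]) (eh _)

comp₂ᶜ : {H : Vec ℕ 2 → ℕ} → Computable H → Computable F → Computable G
       → Computable (λ xs → H (F xs ∷ G xs ∷ []))
comp₂ᶜ (h , eh) (f , ef) (g , eg) =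
  comp h (f ∷ g ∷ []) , λ xs → ev-comp (ev-∷ (ef xs) (ev-∷ (eg xs) ev-[])) (eh _)

primrec : (Vec ℕ n → ℕ) → (Vec ℕ (2 + n) → ℕ) → ℕ → Vec ℕ n → ℕ
primrec G H zero    xs = G xs
primrec G H (suc x) xs = H (x ∷ primrec G H x xs ∷ xs)

precᶜ : {H : Vec ℕ (2 + n) → ℕ} → Computable G → Computable H
      → Computable (λ xs → primrec G H (Vec.head xs) (Vec.tail xs))
precᶜ {G = G} {H} (g , eg) (h , eh) = prec g h , λ { (x ∷ xs) → go x xs }
  where
  go : ∀ x xs → prec g h ⟦ x ∷ xs ⟧⇓ primrec G H x xs
  go zero    xs = ev-prec0 (eg xs)
  go (suc x) xs = ev-precS (go x xs) (eh _)

≗ᶜ : Computable F → (∀ xs → F xs ≡ G xs) → Computable G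
≗ᶜ (f , e) eq = f , λ xs → subst (f ⟦ xs ⟧⇓_) (eq xs) (e xs)

plus : Computable {2} (λ xs → Vec.head xs + lookup xs (Fin.suc Fin.zero))
plus = ≗ᶜ (precᶜ {G = λ xs → lookup xs Fin.zero} (argᶜ Fin.zero) (sucᶜ (argᶜ (Fin.suc Fin.zero))))
  λ { (x ∷ y ∷ []) → eq x y }
  where
  eq : ∀ x y → primrec (λ xs → lookup xs Fin.zero) _ x (y ∷ []) ≡ x + y
  eq zero    y = refl
  eq (suc x) y = cong suc (eq x y)

_+ᶜ_ : Computable F → Computable G → Computable (λ xs → F xs + G xs)
f +ᶜ g = comp₂ᶜ plus f g

triᶜ : Computable F → Computable (λ xs → tri (F xs))
triᶜ f = comp₁ᶜ {H = λ xs → tri (Vec.head xs)}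
  (≗ᶜ (precᶜ {G = λ _ → 0} (constᶜ 0) (sucᶜ (argᶜ Fin.zero) +ᶜ argᶜ (Fin.suc Fin.zero)))
    λ { (x ∷ []) → eq x }) f
  where
  eq : ∀ x → primrec (λ _ → 0) _ x [] ≡ tri x
  eq zero    = refl
  eq (suc x) = cong (λ u → suc (x + u)) (eq x)

consᶜ : Computable F → Computable G → Computable (λ xs → suc (pair (F xs) (G xs)))
consᶜ f g = sucᶜ (triᶜ (f +ᶜ g) +ᶜ g)

-- Chain templates and their codes

Rule : Set
Rule = ℕ × ℕ × ℕ × ℕ

flat : List Rule → List ℕ
flat []                    = []
flat ((c , a , b , d) ∷ r) = c ∷ a ∷ b ∷ d ∷ flat r

link : ℕ → ℕ
link j = suc (j + j)

-- A template is a rule mentioning the chain colours number j and j + 1 for unspecified j.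
data Entry : Set where
  blank cur next : Entry

⟦_⟧ : Entry → ℕ → ℕ
⟦ blank ⟧ j = 0
⟦ cur ⟧   j = link j
⟦ next ⟧  j = link (suc j)

Template : Set
Template = Entry × ℕ × ℕ × Entry

inst : ℕ → Template → Rule
inst j (c , a , b , d) = ⟦ c ⟧ j , a , b , ⟦ d ⟧ j

-- The given list remains the tail, so its code enters the code of the result only as an argument of
-- `pair` and is never decoded.
chainRules : List Template → ℕ → List Rule → List Rule
chainRules ts zero    rs = rs
chainRules ts (suc j) rs = List.map (inst j) ts ++ chainRules ts j rs

entryᶜ : ∀ e → Computable F → Computable (λ xs → ⟦ e ⟧ (F xs))
entryᶜ blank f = constᶜ 0
entryᶜ cur   f = sucᶜ (f +ᶜ f)
entryᶜ next  f = sucᶜ (sucᶜ f +ᶜ sucᶜ f)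

prepend : List Template → ℕ → ℕ → ℕ
prepend []                     j r = r
prepend ((c , a , b , d) ∷ ts) j r =
  suc (pair (⟦ c ⟧ j) (suc (pair a (suc (pair b (suc (pair (⟦ d ⟧ j) (prepend ts j r))))))))

prepend-code : ∀ ts j rs → codeList (flat (List.map (inst j) ts ++ rs)) ≡ prepend ts j (codeList (flat rs))
prepend-code []                     j rs = refl
prepend-code ((c , a , b , d) ∷ ts) j rs =
  cong (λ r → suc (pair (⟦ c ⟧ j) (suc (pair a (suc (pair b (suc (pair (⟦ d ⟧ j) r))))))))
    (prepend-code ts j rs)

prependᶜ : ∀ ts → Computable F → Computable G → Computable (λ xs → prepend ts (F xs) (G xs))
prependᶜ []                     f r = r
prependᶜ ((c , a , b , d) ∷ ts) f r =
  consᶜ (entryᶜ c f) (consᶜ (constᶜ a) (consᶜ (constᶜ b) (consᶜ (entryᶜ d f) (prependᶜ ts f r))))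

chainCode : List Template → ℕ → ℕ → ℕ
chainCode ts zero    r = r
chainCode ts (suc j) r = prepend ts j (chainCode ts j r)

chainCode-code : ∀ ts j rs → codeList (flat (chainRules ts j rs)) ≡ chainCode ts j (codeList (flat rs))
chainCode-code ts zero    rs = refl
chainCode-code ts (suc j) rs = trans (prepend-code ts j _) (cong (prepend ts j) (chainCode-code ts j rs))

chainCodeᶜ : ∀ ts → Computable F → Computable G → Computable (λ xs → chainCode ts (F xs) (G xs))
chainCodeᶜ ts = comp₂ᶜ {H = λ xs → chainCode ts (Vec.head xs) (lookup xs (Fin.suc Fin.zero))}
  (≗ᶜ (precᶜ {G = λ xs → lookup xs Fin.zero} (argᶜ Fin.zero)
         (prependᶜ ts (argᶜ Fin.zero) (argᶜ (Fin.suc Fin.zero))))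
    λ { (x ∷ y ∷ []) → eq x y })
  where
  eq : ∀ x y → primrec (λ xs → lookup xs Fin.zero) _ x (y ∷ []) ≡ chainCode ts x y
  eq zero    y = refl
  eq (suc x) y = cong (prepend ts x) (eq x y)

-- Of the `n + 2` ones, the first is the mark to the left of the machine, the second becomes the 0
-- that opens register 0, and the other `n` are the contents of that register.
chainLength : ℕ → ℕ
chainLength n = suc (suc n)

-- The code of the instance whose fixed rules have code n.
selfCode : List Template → ℕ → ℕ
selfCode ts n = suc (pair (suc (link h)) (suc (pair (link h) (chainCode ts h n))))
  where h = chainLength n

selfCodeᶜ : ∀ ts → Computable {1} (λ xs → selfCode ts (Vec.head xs))
selfCodeᶜ ts = ≗ᶜ
  (consᶜ (sucᶜ (sucᶜ (h +ᶜ h))) (consᶜ (sucᶜ (h +ᶜ h)) (chainCodeᶜ ts h (argᶜ Fin.zero))))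
  λ { (x ∷ []) → refl }
  where
  h : Computable {1} _
  h = sucᶜ (sucᶜ (argᶜ Fin.zero))

-- Colours and rules

bit : Bool → ℕ
bit b = if b then 1 else 0

odd : ℕ → Bool
odd zero    = false
odd (suc n) = not (odd n)

odd-double : ∀ n → odd (n + n) ≡ false
odd-double zero    = refl
odd-double (suc n) rewrite +-suc n n = trans (not-involutive _) (odd-double n)

odd-link : ∀ j → odd (link j) ≡ true
odd-link j = cong not (odd-double j)

encode : ℕ → (ℕ → Bool) → ℕ
encode zero    S = 0
encode (suc N) S = bit (S 0) + (encode N (S ∘ suc) + encode N (S ∘ suc))

testBit : ℕ → ℕ → Bool
testBit c zero    = odd c
testBit c (suc i) = testBit ⌊ c /2⌋ i

half : ∀ b n → ⌊ bit b + (n + n) /2⌋ ≡ n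
half false n = sym (n≡⌊n+n/2⌋ n)
half true  n = go n
  where
  go : ∀ n → ⌊ suc (n + n) /2⌋ ≡ n
  go zero    = refl
  go (suc n) rewrite +-suc n n = cong suc (go n)

odd-bit : ∀ b n → odd (bit b + (n + n)) ≡ b
odd-bit false n = odd-double n
odd-bit true  n = cong not (odd-double n)

testBit-encode : ∀ N S {i} → i < N → testBit (encode N S) i ≡ S i
testBit-encode (suc N) S {zero}  _       = odd-bit (S 0) (encode N (S ∘ suc))
testBit-encode (suc N) S {suc i} (s<s l) =
  trans (cong (λ c → testBit c i) (half (S 0) _)) (testBit-encode N (S ∘ suc) l)

encode-< : ∀ N S → encode N S < 2 ^ N
encode-< zero    S = s≤s z≤n
encode-< (suc N) S = begin-strict
  bit (S 0) + (e + e)      ≤⟨ +-monoˡ-≤ (e + e) (bit≤1 (S 0)) ⟩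
  suc (e + e)              <⟨ n<1+n _ ⟩
  suc (suc (e + e))        ≡⟨ cong suc (+-suc e e) ⟨
  suc e + suc e            ≤⟨ +-mono-≤ (encode-< N _) (encode-< N _) ⟩
  2 ^ N + 2 ^ N            ≡⟨ cong (2 ^ N +_) (+-identityʳ (2 ^ N)) ⟨
  2 ^ suc N                ∎
  where
  open ≤-Reasoning
  e = encode N (S ∘ suc)
  bit≤1 : ∀ b → bit b ≤ 1
  bit≤1 false = z≤n
  bit≤1 true  = ≤-refl

encode-∅ : ∀ N {S} → (∀ i → S i ≡ false) → encode N S ≡ 0
encode-∅ zero    h = refl
encode-∅ (suc N) {S} h rewrite h 0 | encode-∅ N {S ∘ suc} (h ∘ suc) = refl

encode-cong : ∀ N {S S′} → (∀ i → S i ≡ S′ i) → encode N S ≡ encode N S′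
encode-cong zero    h = refl
encode-cong (suc N) h = cong₂ (λ b e → bit b + (e + e)) (h 0) (encode-cong N (h ∘ suc))

-- The odd colours are those of the chain; the even colour 2c stands for the set of states
-- with characteristic word c.
member : ℕ → ℕ → Bool
member c i = not (odd c) ∧ testBit c (suc i)

setColour : ℕ → (ℕ → Bool) → ℕ
setColour N S = encode N S + encode N S

member-setColour : ∀ N S {i} → i < N → member (setColour N S) i ≡ S i
member-setColour N S {i} l = cong₂ _∧_ (cong not (odd-double (encode N S)))
  (trans (cong (λ c → testBit c i) (half false (encode N S))) (testBit-encode N S l))

testBit-0 : ∀ i → testBit 0 i ≡ false
testBit-0 zero    = refl
testBit-0 (suc i) = testBit-0 i

member-blank : ∀ i → ¬ T (member 0 i)
member-blank i t = subst T (testBit-0 i) t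

member-link : ∀ j i → ¬ T (member (link j) i)
member-link j i t = subst (λ b → T (not b ∧ testBit (link j) (suc i))) (odd-link j) t

tri-≥ : ∀ n → n ≤ tri n
tri-≥ zero    = z≤n
tri-≥ (suc n) = m≤m+n (suc n) (tri n)

pair-≥ˡ : ∀ a b → a ≤ pair a b
pair-≥ˡ a b = ≤-trans (m≤m+n a b) (≤-trans (tri-≥ (a + b)) (m≤m+n (tri (a + b)) b))

∈⇒<codeList : ∀ {x xs} → x ∈ xs → x < codeList xs
∈⇒<codeList {xs = a ∷ xs} (here refl) = s≤s (pair-≥ˡ a (codeList xs))
∈⇒<codeList {xs = a ∷ xs} (there i)   = m≤n⇒m≤1+n (≤-trans (∈⇒<codeList i) (m≤n+m (codeList xs) _))

∈-flat : ∀ {c a b d rs} → (c , a , b , d) ∈ rs → c ∈ flat rs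
∈-flat (here refl) = here refl
∈-flat (there i)   = there (there (there (there (∈-flat i))))

InBounds : ℕ → ℕ → ℕ → Rule → Set
InBounds k p q (c , a , b , d) = c < k × a < p × b < q × d < k

module _ {k p q : ℕ} where

  erase : Fin k × Fin p × Fin q × Fin k → Rule
  erase (c , a , b , d) = toℕ c , toℕ a , toℕ b , toℕ d

  codeΠ-erase : ∀ rs → codeΠ rs ≡ flat (List.map erase rs)
  codeΠ-erase []                     = refl
  codeΠ-erase ((c , a , b , d) ∷ rs) =
    cong (λ l → toℕ c ∷ toℕ a ∷ toℕ b ∷ toℕ d ∷ l) (codeΠ-erase rs)

  unerase : ∀ {rs} → All (InBounds k p q) rs → ∃ λ Π → List.map erase Π ≡ rs
  unerase [] = [] , refl
  unerase {(c , a , b , d) ∷ rs} ((l₁ , l₂ , l₃ , l₄) ∷ bs) with unerase bs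
  ... | Π , eq = (fromℕ< l₁ , fromℕ< l₂ , fromℕ< l₃ , fromℕ< l₄) ∷ Π ,
    cong₂ _∷_ (cong₂ _,_ (toℕ-fromℕ< l₁) (cong₂ _,_ (toℕ-fromℕ< l₂)
      (cong₂ _,_ (toℕ-fromℕ< l₃) (toℕ-fromℕ< l₄)))) eq

-- The chain passes through vertices coloured link h, …, link 0, where link (suc j) forces link j
-- below it along the label (1,0); all other neighbours are blank.
data FromTemplate (p q j : ℕ) : Rule → Set where
  descend : FromTemplate p q j (link j , 1 , 0 , link (suc j))
  upper   : ∀ {a b} → a < p → b < q → FromTemplate p q j (link (suc j) , a , b , 0)
  lower   : ∀ {a} → a < p → a ≢ 1 → FromTemplate p q j (0 , a , 0 , link (suc j))

opaque
  template : ℕ → ℕ → List Template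
  template p q = (cur , 1 , 0 , next)
    ∷ List.map (λ (a , b) → next , a , b , blank) (cartesianProduct (upTo p) (upTo q))
    ++ List.map (λ a → blank , a , 0 , next) (filter (λ a → ¬? (a ≟ 1)) (upTo p))

  ∈-template⁺ : ∀ {p q j r} → FromTemplate p q j r → r ∈ List.map (inst j) (template p q)
  ∈-template⁺ descend = here refl
  ∈-template⁺ {p} {q} {j} (upper l l′) = there (∈-map⁺ (inst j)
    (∈-++⁺ˡ (∈-map⁺ _ (∈-cartesianProduct⁺ (∈-upTo⁺ l) (∈-upTo⁺ l′)))))
  ∈-template⁺ {p} {q} {j} (lower l ne) = there (∈-map⁺ (inst j)
    (∈-++⁺ʳ (List.map _ (cartesianProduct (upTo p) (upTo q)))
      (∈-map⁺ _ (∈-filter⁺ (λ a → ¬? (a ≟ 1)) (∈-upTo⁺ l) ne))))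

  ∈-template⁻ : ∀ {p q j r} → r ∈ List.map (inst j) (template p q) → FromTemplate p q j r
  ∈-template⁻ (here refl) = descend
  ∈-template⁻ {p} {q} {j} (there i) with ∈-map⁻ (inst j) i
  ... | t , t∈ , refl with ∈-++⁻ (List.map _ (cartesianProduct (upTo p) (upTo q))) t∈
  ... | inj₁ t∈₁ with ∈-map⁻ _ t∈₁
  ...   | (a , b) , ab∈ , refl with ∈-cartesianProduct⁻ (upTo p) (upTo q) ab∈
  ...     | a∈ , b∈ = upper (∈-upTo⁻ a∈) (∈-upTo⁻ b∈)
  ∈-template⁻ {p} {q} {j} (there i) | t , t∈ , refl | inj₂ t∈₂ with ∈-map⁻ _ t∈₂
  ...   | a , a∈ , refl with ∈-filter⁻ (λ a → ¬? (a ≟ 1)) {xs = upTo p} a∈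
  ...     | a∈′ , ne = lower (∈-upTo⁻ a∈′) ne

∈-chainRules⁺ : ∀ {ts j h r rs} → j < h → r ∈ List.map (inst j) ts → r ∈ chainRules ts h rs
∈-chainRules⁺ {ts} {j} {suc h} l r∈ with m≤n⇒m<n∨m≡n (s≤s⁻¹ l)
... | inj₁ l′   = ∈-++⁺ʳ (List.map (inst h) ts) (∈-chainRules⁺ l′ r∈)
... | inj₂ refl = ∈-++⁺ˡ r∈

∈-chainRules-rest : ∀ ts h {r rs} → r ∈ rs → r ∈ chainRules ts h rs
∈-chainRules-rest ts zero    r∈ = r∈
∈-chainRules-rest ts (suc h) r∈ = ∈-++⁺ʳ (List.map (inst h) ts) (∈-chainRules-rest ts h r∈)

∈-chainRules⁻ : ∀ ts h {r rs} → r ∈ chainRules ts h rs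
              → (∃ λ j → j < h × r ∈ List.map (inst j) ts) ⊎ r ∈ rs
∈-chainRules⁻ ts zero    r∈ = inj₂ r∈
∈-chainRules⁻ ts (suc h) r∈ with ∈-++⁻ (List.map (inst h) ts) r∈
... | inj₁ r∈₁ = inj₁ (h , n<1+n h , r∈₁)
... | inj₂ r∈₂ with ∈-chainRules⁻ ts h r∈₂
...   | inj₁ (j , l , r∈₃) = inj₁ (j , m≤n⇒m≤1+n l , r∈₃)
...   | inj₂ r∈₃           = inj₂ r∈₃

-- Machines and the rules of their instances

record Finite (X : Set) : Set where
  field
    N       : ℕ
    index   : X → ℕ
    index-< : ∀ x → index x < N
    index-injective : ∀ {x y} → index x ≡ index y → x ≡ y
    states  : List X
    listed  : ∀ x → x ∈ states

record Machine : Set₁ where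
  field
    X        : Set
    X-finite : Finite X
    Δ        : X → Action X
    start    : X
  open Finite X-finite public

module Rules (M : Machine) {p q : ℕ} (2≤p : 2 ≤ p) (2≤q : 2 ≤ q) where
  open Machine M

  -- A bad state is forbidden at the lower endpoint only; this suffices, since every vertex is the
  -- lower endpoint of some edge.
  Forced : Action X → X → Bool → Rule → Set
  Forced (move ▸ w nx) x β (c , a , b , d) =
    T (member c (index x)) → a ≡ bit β → b ≡ bit (w β) → T (member d (index (nx β)))
  Forced (move ◂ w nx) x β (c , a , b , d) =
    T (member d (index x)) → b ≡ bit β → a ≡ bit (w β) → T (member c (index (nx β)))
  Forced good _ _ _ = ⊤
  Forced bad  x _ (c , _) = ¬ T (member c (index x))

  Closed : Rule → Set
  Closed r = ∀ x β → Forced (Δ x) x β r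

  forced? : ∀ α x β r → Dec (Forced α x β r)
  forced? (move ▸ w nx) x β (c , a , b , d) =
    T? _ →-dec (a ≟ bit β) →-dec (b ≟ bit (w β)) →-dec T? _
  forced? (move ◂ w nx) x β (c , a , b , d) =
    T? _ →-dec (b ≟ bit β) →-dec (a ≟ bit (w β)) →-dec T? _
  forced? good x β r       = yes tt
  forced? bad  x β (c , _) = ¬? (T? _)

  closed? : Decidable Closed
  closed? r with All.all? (λ x → forced? (Δ x) x false r ×-dec forced? (Δ x) x true r) states
  ... | yes all = yes λ where
    x false → proj₁ (All.lookup all (listed x))
    x true  → proj₂ (All.lookup all (listed x))
  ... | no ¬all = no λ cl → ¬all (All.tabulate λ {x} _ → cl x false , cl x true)

  -- The number 1 is `link 0`, the colour at the bottom of the chain. The second clause starts the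
  -- machine above it when a 1 is kept as the mark. The third clause prevents the fixed rules, which
  -- may contain further odd colours, from offering an alternative to `descend` below any other
  -- chain colour.
  Admissible : Rule → Set
  Admissible r@(c , a , b , d) = Closed r
    × (c ≡ 1 → a ≡ 1 → b ≡ 1 → T (member d (index start)))
    × (a ≡ 1 → b ≡ 0 → T (odd d) → d ≡ 1)

  admissible? : Decidable Admissible
  admissible? r@(c , a , b , d) = closed? r
    ×-dec ((c ≟ 1) →-dec (a ≟ 1) →-dec (b ≟ 1) →-dec T? _)
    ×-dec ((a ≟ 1) →-dec (b ≟ 0) →-dec T? _ →-dec (d ≟ 1))

  colourBound : ℕ
  colourBound = suc (link (2 ^ N))

  allRules : List Rule
  allRules = cartesianProduct (upTo colourBound)
    (cartesianProduct (upTo p) (cartesianProduct (upTo q) (upTo colourBound)))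

  opaque
    fixedRules : List Rule
    fixedRules = filter admissible? allRules

    ∈-fixedRules⁺ : ∀ {c a b d} → InBounds colourBound p q (c , a , b , d) → Admissible (c , a , b , d)
                  → (c , a , b , d) ∈ fixedRules
    ∈-fixedRules⁺ (c< , a< , b< , d<) = ∈-filter⁺ admissible? (∈-cartesianProduct⁺ (∈-upTo⁺ c<)
      (∈-cartesianProduct⁺ (∈-upTo⁺ a<) (∈-cartesianProduct⁺ (∈-upTo⁺ b<) (∈-upTo⁺ d<))))

    ∈-fixedRules⁻ : ∀ {r} → r ∈ fixedRules → Admissible r × InBounds colourBound p q r
    ∈-fixedRules⁻ {c , a , b , d} r∈ with ∈-filter⁻ admissible? {xs = allRules} r∈
    ... | r∈′ , ad with ∈-cartesianProduct⁻ (upTo colourBound) _ r∈′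
    ... | c∈ , r∈₁ with ∈-cartesianProduct⁻ (upTo p) _ r∈₁
    ... | a∈ , r∈₂ with ∈-cartesianProduct⁻ (upTo q) (upTo colourBound) r∈₂
    ... | b∈ , d∈ = ad , ∈-upTo⁻ c∈ , ∈-upTo⁻ a∈ , ∈-upTo⁻ b∈ , ∈-upTo⁻ d∈

  Empty : ℕ → Set
  Empty c = ∀ i → ¬ T (member c i)

  closed-empty : ∀ {c a b d} → Empty c → Empty d → Closed (c , a , b , d)
  closed-empty ec ed x β with Δ x
  ... | move ▸ _ _ = λ t → contradiction t (ec (index x))
  ... | move ◂ _ _ = λ t → contradiction t (ed (index x))
  ... | good       = tt
  ... | bad        = ec (index x)

  fixedCode : ℕ
  fixedCode = codeList (flat fixedRules)

  0<p : 0 < p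
  0<p = <⇒≤ 2≤p
  0<q : 0 < q
  0<q = <⇒≤ 2≤q

  -- The largest colour below the bound, `link (2 ^ N)`, is odd and thus stands for no states; with
  -- the label (0,0) it may be adjacent to itself. Being an entry of the fixed list, it is smaller
  -- than the code of the list. So a chain longer than `fixedCode` leaves room for all set colours
  -- without a further parameter in `selfCode`.
  colourBound≤fixedCode : colourBound ≤ fixedCode
  colourBound≤fixedCode = ∈⇒<codeList (∈-flat (∈-fixedRules⁺
    (≤-refl , 0<p , 0<q , ≤-refl)
    ( closed-empty (member-link (2 ^ N)) (member-link (2 ^ N))
    , (λ _ ()) , (λ ()))))

  opaque
    h : ℕ
    h = chainLength fixedCode

    h-≡ : h ≡ chainLength fixedCode
    h-≡ = refl

    rules : List Rule
    rules = chainRules (template p q) h fixedRules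

    rules-≡ : rules ≡ chainRules (template p q) h fixedRules
    rules-≡ = refl

    chain-rule : ∀ {j r} → j < h → FromTemplate p q j r → r ∈ rules
    chain-rule j<h t = ∈-chainRules⁺ j<h (∈-template⁺ t)

    fixed-rule : ∀ {c a b d} → InBounds colourBound p q (c , a , b , d) → Admissible (c , a , b , d)
               → (c , a , b , d) ∈ rules
    fixed-rule b ad = ∈-chainRules-rest (template p q) h (∈-fixedRules⁺ b ad)

    ∈-rules⁻ : ∀ {r} → r ∈ rules
             → (∃ λ j → j < h × FromTemplate p q j r) ⊎ (Admissible r × InBounds colourBound p q r)
    ∈-rules⁻ r∈ with ∈-chainRules⁻ (template p q) h r∈
    ... | inj₁ (j , j<h , r∈₁) = inj₁ (j , j<h , ∈-template⁻ r∈₁)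
    ... | inj₂ r∈₁             = inj₂ (∈-fixedRules⁻ r∈₁)

  rules-closed : ∀ {r} → r ∈ rules → Closed r
  rules-closed r∈ with ∈-rules⁻ r∈
  ... | inj₂ (ad , _)            = proj₁ ad
  ... | inj₁ (j , _ , descend)   = closed-empty (member-link j) (member-link (suc j))
  ... | inj₁ (j , _ , upper _ _) = closed-empty (member-link (suc j)) member-blank
  ... | inj₁ (j , _ , lower _ _) = closed-empty member-blank (member-link (suc j))

  link-injective : ∀ {i j} → link i ≡ link j → i ≡ j
  link-injective {i} {j} eq =
    trans (n≡⌊n+n/2⌋ i) (trans (cong ⌊_/2⌋ (suc-injective eq)) (sym (n≡⌊n+n/2⌋ j)))

  -- A fixed rule with this label has no odd upper colour except `link 0`, an `upper` rule ends in
  -- 0, and a `lower` rule excludes the label 1 at its lower end; `descend` is all that remains.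
  rules-descend : ∀ {c j} → (c , 1 , 0 , link (suc j)) ∈ rules → c ≡ link j
  rules-descend {c} {j} r∈ = go r∈ refl
    where
    go : ∀ {r} → r ∈ rules → r ≡ (c , 1 , 0 , link (suc j)) → c ≡ link j
    go r∈ eq with ∈-rules⁻ r∈
    go r∈ refl | inj₂ (ad , _) = contradiction
      (proj₂ (proj₂ ad) refl refl (subst T (sym (odd-link (suc j))) tt)) λ ()
    go r∈ eq | inj₁ (i , _ , descend) =
      trans (sym (cong proj₁ eq)) (cong link (suc-injective (link-injective (cong (proj₂ ∘ proj₂ ∘ proj₂) eq))))
    go r∈ () | inj₁ (i , _ , upper _ _)
    go r∈ eq | inj₁ (i , _ , lower _ ne) = contradiction (cong (proj₁ ∘ proj₂) eq) ne

  rules-start : ∀ {d} → (1 , 1 , 1 , d) ∈ rules → T (member d (index start))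
  rules-start {d} r∈ = go r∈ refl
    where
    go : ∀ {r} → r ∈ rules → r ≡ (1 , 1 , 1 , d) → T (member d (index start))
    go r∈ eq with ∈-rules⁻ r∈
    go r∈ refl | inj₂ (ad , _) = proj₁ (proj₂ ad) refl refl refl
    go r∈ () | inj₁ (i , _ , descend)
    go r∈ eq | inj₁ (i , _ , upper _ _) with () ← link-injective {suc i} {0} (cong proj₁ eq)
    go r∈ () | inj₁ (i , _ , lower _ _)

  colours : ℕ
  colours = suc (link h)

  link-mono : ∀ {i j} → i ≤ j → link i ≤ link j
  link-mono l = s≤s (+-mono-≤ l l)

  colourBound≤colours : colourBound ≤ colours
  colourBound≤colours = ≤-trans colourBound≤fixedCode (m≤n⇒m≤1+n (m≤n⇒m≤1+n
    (≤-trans (m≤n+m fixedCode 2) (≤-trans (≤-reflexive (sym h-≡)) (m≤m+n h h)))))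

  rules-bounded : All (InBounds colours p q) rules
  rules-bounded = All.tabulate bounded
    where
    bounded : ∀ {r} → r ∈ rules → InBounds colours p q r
    bounded r∈ with ∈-rules⁻ r∈
    ... | inj₂ (_ , c< , a< , b< , d<) =
      <-≤-trans c< colourBound≤colours , a< , b< , <-≤-trans d< colourBound≤colours
    ... | inj₁ (j , j<h , descend)     = s≤s (link-mono (<⇒≤ j<h)) , 2≤p , 0<q , s≤s (link-mono j<h)
    ... | inj₁ (j , j<h , upper a< b<) = s≤s (link-mono j<h) , a< , b< , z<s
    ... | inj₁ (j , j<h , lower a< _)  = z<s , a< , 0<q , s≤s (link-mono j<h)

-- Tapes as vertices

open import Data.Integer using (ℤ; +_; -[1+_]; ∣_∣)

nth : List Bool → ℕ → Bool
nth []       _       = false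
nth (b ∷ _)  zero    = b
nth (_ ∷ bs) (suc t) = nth bs t

nth-≥ : ∀ bs {t} → length bs ≤ t → nth bs t ≡ false
nth-≥ []       l       = refl
nth-≥ (_ ∷ bs) (s≤s l) = nth-≥ bs l

nth-0 : ∀ r → nth r 0 ≡ hd r
nth-0 []      = refl
nth-0 (_ ∷ _) = refl

nth-suc : ∀ r t → nth r (suc t) ≡ nth (tl r) t
nth-suc []      t = refl
nth-suc (_ ∷ _) t = refl

nth-ʳ++ : ∀ l r t → nth (l ʳ++ r) (length l + t) ≡ nth r t
nth-ʳ++ []      r t = refl
nth-ʳ++ (x ∷ l) r t = trans (cong (nth (l ʳ++ (x ∷ r))) (sym (+-suc (length l) t))) (nth-ʳ++ l (x ∷ r) (suc t))

nth-head : ∀ l r → nth (l ʳ++ r) (length l) ≡ hd r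
nth-head l r = trans (cong (nth (l ʳ++ r)) (sym (+-identityʳ (length l)))) (trans (nth-ʳ++ l r 0) (nth-0 r))

nth-< : ∀ l {r r′ t} → t < length l → nth (l ʳ++ r) t ≡ nth (l ʳ++ r′) t
nth-< (x ∷ l) {r} {r′} (s≤s t≤) with m≤n⇒m<n∨m≡n t≤
... | inj₁ t<   = nth-< l t<
... | inj₂ refl = trans (nth-head l (x ∷ r)) (sym (nth-head l (x ∷ r′)))

nth-write : ∀ l r b {t} → t ≢ length l → nth (l ʳ++ (b ∷ tl r)) t ≡ nth (l ʳ++ r) t
nth-write l r b {t} ne with <-cmp t (length l)
... | tri< t< _ _ = nth-< l t<
... | tri≈ _ eq _ = contradiction eq ne
... | tri> _ _ t> with m≤n⇒∃[o]m+o≡n t>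
...   | s , refl = begin
  nth (l ʳ++ (b ∷ tl r)) (suc (length l + s))  ≡⟨ cong (nth (l ʳ++ (b ∷ tl r))) (+-suc (length l) s) ⟨
  nth (l ʳ++ (b ∷ tl r)) (length l + suc s)    ≡⟨ nth-ʳ++ l (b ∷ tl r) (suc s) ⟩
  nth (tl r) s                                 ≡⟨ nth-suc r s ⟨
  nth r (suc s)                                ≡⟨ nth-ʳ++ l r (suc s) ⟨
  nth (l ʳ++ r) (length l + suc s)             ≡⟨ cong (nth (l ʳ++ r)) (+-suc (length l) s) ⟩
  nth (l ʳ++ r) (suc (length l + s))           ∎
  where open ≡-Reasoning

-- The cell of a tape numbered t lies at position t − h + ½.
module Geometry {p q : ℕ} (2≤p : 2 ≤ p) (2≤q : 2 ≤ q) (h : ℕ) where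

  at : List Bool → ℤ → ℕ
  at bs (+ t)    = bit (nth bs t)
  at bs -[1+ _ ] = 0

  labelAt : List Bool → ℤ → ℕ
  labelAt bs i = at bs (i ℤ.+ + h)

  contents : Tape → List Bool
  contents (l , r) = l ʳ++ r

  position : Tape → ℤ
  position (l , _) = + length l ℤ.- + h

  cell-position : ∀ t → (+ t ℤ.- + h) ℤ.+ + h ≡ + t
  cell-position t = trans (ℤ.+-assoc (+ t) (ℤ.- + h) (+ h))
    (trans (cong (λ z → + t ℤ.+ z) (ℤ.+-inverseˡ (+ h))) (ℤ.+-identityʳ (+ t)))

  position-injective : ∀ s t → + s ℤ.- + h ≡ + t ℤ.- + h → s ≡ t
  position-injective s t eq = ℤ.+-injective
    (trans (sym (cell-position s)) (trans (cong (ℤ._+ + h) eq) (cell-position t)))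

  labelAt-cell : ∀ bs t → labelAt bs (+ t ℤ.- + h) ≡ bit (nth bs t)
  labelAt-cell bs t = cong (at bs) (cell-position t)

  labelAt-write : ∀ l r b {i} → i ≢ position (l , r)
                → labelAt (l ʳ++ (b ∷ tl r)) i ≡ labelAt (l ʳ++ r) i
  labelAt-write l r b {i} ne with i ℤ.+ + h in eq
  ... | -[1+ _ ] = refl
  ... | + t      = cong bit (nth-write l r b {t} λ { refl → ne
    (trans (sym (ℤ.+-identityʳ i)) (trans (cong (λ z → i ℤ.+ z) (sym (ℤ.+-inverseʳ (+ h))))
      (trans (sym (ℤ.+-assoc i (+ h) (ℤ.- + h))) (cong (ℤ._- + h) eq)))) })

  bit<2 : ∀ b → bit b < 2
  bit<2 false = z<s
  bit<2 true  = ≤-refl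

  labelAt<2 : ∀ bs i → labelAt bs i < 2
  labelAt<2 bs i with i ℤ.+ + h
  ... | + t      = bit<2 _
  ... | -[1+ _ ] = z<s

  labelAt-high : ∀ bs i → suc (h + length bs) ≤ ∣ i ∣ → labelAt bs i ≡ 0
  labelAt-high bs (+ t) l = cong bit (nth-≥ bs (≤-trans (m≤n+m (length bs) h) (≤-trans (<⇒≤ l) (m≤m+n t h))))
  labelAt-high bs -[1+ t ] l rewrite ℤ.⊖-< {h} {suc t} (≤-trans (s≤s (m≤m+n h (length bs))) l)
    with suc t ∸ h | m<n⇒0<n∸m {h} {suc t} (≤-trans (s≤s (m≤m+n h (length bs))) l)
  ... | suc _ | _ = refl

  vertex : Tape → Vertex p q
  vertex τ = record
    { pos     = position τ
    ; lab     = labelAt (contents τ)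
    ; below   = λ i _ → <-≤-trans (labelAt<2 (contents τ) i) 2≤q
    ; above   = λ i _ → <-≤-trans (labelAt<2 (contents τ) i) 2≤p
    ; finSupp = suc (h + length (contents τ)) , labelAt-high (contents τ)
    }

  infix 4 _≈_
  _≈_ : Vertex p q → Tape → Set
  v ≈ τ = SameVertex v (vertex τ)

  -- Both labellings vanish outside a common bounded interval, so finitely many positions, taken in
  -- pairs `t` and `- t`, decide equality.
  labels? : (v : Vertex p q) (bs : List Bool) → Dec (∀ i → lab v i ≡ labelAt bs i)
  labels? v bs with finSupp v
  ... | M , high = map′ extend (λ eq {t} _ → eq (+ t) , eq (ℤ.- + t))
    (allUpTo? (λ t → (lab v (+ t) ≟ labelAt bs (+ t)) ×-dec (lab v (ℤ.- + t) ≟ labelAt bs (ℤ.- + t))) B)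
    where
    B = M ⊔ suc (h + length bs)
    far : ∀ i → B ≤ ∣ i ∣ → lab v i ≡ labelAt bs i
    far i l = trans (high i (≤-trans (m≤m⊔n M _) l)) (sym (labelAt-high bs i (≤-trans (m≤n⊔m M _) l)))
    extend : _ → ∀ i → lab v i ≡ labelAt bs i
    extend near i with ∣ i ∣ <? B
    extend near i        | no  ≮ = far i (≮⇒≥ ≮)
    extend near (+ t)    | yes l = proj₁ (near l)
    extend near -[1+ t ] | yes l = proj₂ (near l)

  _≈?_ : ∀ v τ → Dec (v ≈ τ)
  v ≈? τ = (pos v ℤ.≟ position τ) ×-dec labels? v (contents τ)

  ≈-resp : ∀ v w τ → SameVertex v w → v ≈ τ → w ≈ τ
  ≈-resp v w τ (p , l) (p′ , l′) = trans (sym p) p′ , λ i → trans (sym (l i)) (l′ i)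

  ≈-read : ∀ {v l r} → v ≈ (l , r) → lab v (pos v) ≡ bit (hd r)
  ≈-read {v} {l} {r} (refl , eq) = trans (eq _)
    (trans (labelAt-cell (l ʳ++ r) (length l)) (cong bit (nth-head l r)))

  suc-position : ∀ t → + suc t ℤ.- + h ≡ (+ t ℤ.- + h) ℤ.+ ℤ.1ℤ
  suc-position t = trans (cong (ℤ._- + h) (ℤ.+-comm (+ 1) (+ t)))
    (trans (ℤ.+-assoc (+ t) (+ 1) (ℤ.- + h))
      (trans (cong (λ z → + t ℤ.+ z) (ℤ.+-comm (+ 1) (ℤ.- + h))) (sym (ℤ.+-assoc (+ t) (ℤ.- + h) (+ 1)))))

  ≈-right : ∀ {v w l r b} → v ≈ (l , r) → Edge v w → lab w (pos v) ≡ bit b → w ≈ (b ∷ l , tl r)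
  ≈-right {v} {w} {l} {r} {b} (refl , eq) (pw , agree) wb = trans pw (sym (suc-position (length l))) , labels
    where
    labels : ∀ i → lab w i ≡ labelAt (l ʳ++ (b ∷ tl r)) i
    labels i with i ℤ.≟ pos v
    ... | yes refl = trans wb (sym (trans (labelAt-cell (l ʳ++ (b ∷ tl r)) (length l))
      (cong bit (nth-head l (b ∷ tl r)))))
    ... | no  ne   = trans (sym (agree i ne)) (trans (eq i) (sym (labelAt-write l r b ne)))

  lower-position : ∀ {v w a l r} → w ≈ (a ∷ l , r) → Edge v w → pos v ≡ + length l ℤ.- + h
  lower-position {v} {l = l} (pw , _) (pw′ , _) = ℤ-cancelʳ ℤ.1ℤ (pos v) _
    (trans (sym pw′) (trans pw (suc-position (length l))))

  ≈-left : ∀ {v w a b l r} → w ≈ (a ∷ l , r) → Edge v w → lab v (pos v) ≡ bit b → v ≈ (l , b ∷ r)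
  ≈-left {v} {w} {a} {b} {l} {r} (pw , eq) e@(pw′ , agree) vb = pv , labels
    where
    pv = lower-position {v} {w} {a} {l} {r} (pw , eq) e
    labels : ∀ i → lab v i ≡ labelAt (l ʳ++ (b ∷ r)) i
    labels i with i ℤ.≟ pos v
    ... | yes refl = trans vb (sym (trans (cong (labelAt (l ʳ++ (b ∷ r))) pv)
      (trans (labelAt-cell (l ʳ++ (b ∷ r)) (length l)) (cong bit (nth-head l (b ∷ r))))))
    ... | no  ne   = trans (agree i ne) (trans (eq i) (labelAt-write l (b ∷ r) a λ i≡ → ne (trans i≡ (sym pv))))

  ≈-write : ∀ {v w a l r} → w ≈ (a ∷ l , r) → Edge v w → lab w (pos v) ≡ bit a
  ≈-write {v} {w} {a} {l} {r} (pw , eq) e = trans (eq (pos v))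
    (trans (cong (labelAt (l ʳ++ (a ∷ r))) (lower-position {v} {w} {a} {l} {r} (pw , eq) e))
      (trans (labelAt-cell (l ʳ++ (a ∷ r)) (length l)) (cong bit (nth-head l (a ∷ r)))))

  vertex-edge : ∀ l r b → Edge (vertex (l , r)) (vertex (b ∷ l , tl r))
  vertex-edge l r b = suc-position (length l) , λ i ne → sym (labelAt-write l r b ne)

-- Tilings and runs

nth-zeros : ∀ m t → nth (zeros m) t ≡ false
nth-zeros zero    t       = refl
nth-zeros (suc m) zero    = refl
nth-zeros (suc m) (suc t) = nth-zeros m t

nth-++-zeros : ∀ bs z t → nth (bs ++ zeros z) t ≡ nth bs t
nth-++-zeros []       z t       = nth-zeros z t
nth-++-zeros (b ∷ bs) z zero    = refl
nth-++-zeros (b ∷ bs) z (suc t) = nth-++-zeros bs z t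

zeros-ʳ++ : ∀ m n → zeros m ʳ++ zeros n ≡ zeros (m + n)
zeros-ʳ++ zero    n = refl
zeros-ʳ++ (suc m) n = trans (zeros-ʳ++ m (suc n)) (cong zeros (+-suc m n))

nth-zeros-ʳ++ : ∀ m r → nth (zeros (suc m) ʳ++ r) 0 ≡ false
nth-zeros-ʳ++ m r = trans (nth-< (zeros (suc m)) {r} {[]} z<s)
  (trans (cong (λ u → nth u 0) (zeros-ʳ++ (suc m) 0)) (nth-zeros (suc m + 0) 0))

-- The machine stays to the right of the last 1 written by the chain. Hence all its
-- configurations have a 1 there, which keeps them away from the neighbours of the chain.
embed : Tape → Tape
embed (l , r) = l ++ [ true ] , r

embed-mark : ∀ τ → nth (proj₁ (embed τ) ʳ++ proj₂ τ) 0 ≡ true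
embed-mark (l , r) = cong (λ u → nth u 0) (++-ʳ++ l {[ true ]} {r})

startTape : ℕ → ℕ → Tape
startTape n z = [] , ones (suc n) ++ zeros z

module Tiling (M : Machine) {p q : ℕ} (2≤p : 2 ≤ p) (2≤q : 2 ≤ q) where
  open Machine M
  open Rules M 2≤p 2≤q
  open Geometry 2≤p 2≤q h

  opaque
    tileRules : List (Fin colours × Fin p × Fin q × Fin colours)
    tileRules = proj₁ (unerase rules-bounded)

    erase-tileRules : List.map erase tileRules ≡ rules
    erase-tileRules = proj₂ (unerase rules-bounded)

  tiles : Instance p q
  tiles = record { k = colours ; c₀ = fromℕ< (n<1+n (link h)) ; Π = tileRules }

  code-tiles : code tiles ≡ selfCode (template p q) fixedCode
  code-tiles = begin
    codeList (colours ∷ toℕ (c₀ tiles) ∷ codeΠ tileRules)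
      ≡⟨ cong₂ (λ c r → codeList (colours ∷ c ∷ r)) (toℕ-fromℕ< (n<1+n (link h))) eq ⟩
    codeList (colours ∷ link h ∷ flat (chainRules (template p q) h fixedRules))
      ≡⟨ cong (λ r → suc (pair colours (suc (pair (link h) r)))) (chainCode-code (template p q) h fixedRules) ⟩
    instanceCode h
      ≡⟨ cong instanceCode h-≡ ⟩
    selfCode (template p q) fixedCode ∎
    where
    open ≡-Reasoning
    eq : codeΠ tileRules ≡ flat (chainRules (template p q) h fixedRules)
    eq = trans (codeΠ-erase tileRules) (cong flat (trans erase-tileRules rules-≡))
    instanceCode : ℕ → ℕ
    instanceCode h = suc (pair (suc (link h)) (suc (pair (link h) (chainCode (template p q) h fixedCode))))

  -- `chain h` is the seed; each step down turns the 0 just passed into a 1, and `chain 0` is the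
  -- bottom, with all the ones to the right of the marker.
  chain : ℕ → Tape
  chain j = zeros j , ones (h ∸ j)

  chain-next : ∀ {j} → j < h → chain j ≡ (zeros j , true ∷ ones (h ∸ suc j))
  chain-next {j} j<h = cong (λ n → zeros j , ones n) (+-∸-assoc 1 j<h)

  vertex-≈ : ∀ τ → vertex τ ≈ τ
  vertex-≈ τ = refl , λ _ → refl

  origin : position (zeros h , []) ≡ + 0
  origin = trans (cong (λ n → + n ℤ.- + h) (length-replicate h)) (ℤ.+-inverseʳ (+ h))

  blank-labels : ∀ i → labelAt (zeros h ʳ++ []) i ≡ 0
  blank-labels i with i ℤ.+ + h
  ... | + t      = cong bit (trans (cong (λ u → nth u t) (zeros-ʳ++ h 0)) (nth-zeros (h + 0) t))
  ... | -[1+ _ ] = refl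

  -- The programs want empty registers written out as zeros, while the chain writes ones only. As
  -- vertices the two tapes agree.
  start-≈ : ∀ z → SameVertex (vertex ([ true ] , ones (suc fixedCode))) (vertex (embed (startTape fixedCode z)))
  start-≈ z = refl , λ i → pad (i ℤ.+ + h)
    where
    bs = ones (suc fixedCode)
    pad : ∀ i → at (true ∷ bs) i ≡ at (true ∷ bs ++ zeros z) i
    pad (+ t)    = cong bit (sym (nth-++-zeros (true ∷ bs) z t))
    pad -[1+ _ ] = refl

  -- A tiling follows the run

  module Forcing (κ : Vertex p q → Fin colours) (tiling : IsTiling tiles κ) where

    colour : Vertex p q → ℕ
    colour v = toℕ (κ v)

    edge-rule : ∀ {v w a b} → Edge v w → lab v (pos v) ≡ a → lab w (pos v) ≡ b
              → (colour v , a , b , colour w) ∈ rules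
    edge-rule {v} {w} e refl refl with proj₂ (proj₂ tiling) v w e
    ... | a , b , eqa , eqb , r∈ = subst₂ (λ a b → (colour v , a , b , colour w) ∈ rules) eqa eqb
      (subst ((colour v , toℕ a , toℕ b , colour w) ∈_) erase-tileRules (∈-map⁺ erase r∈))

    move-rule : ∀ l r b
              → (colour (vertex (l , r)) , bit (hd r) , bit b , colour (vertex (b ∷ l , tl r))) ∈ rules
    move-rule l r b = edge-rule (vertex-edge l r b) (≈-read {v} {l} {r} (vertex-≈ (l , r)))
      (≈-write {v} {w} {b} {l} {tl r} (vertex-≈ (b ∷ l , tl r)) (vertex-edge l r b))
      where
      v = vertex (l , r)
      w = vertex (b ∷ l , tl r)

    -- Induction on the distance `i` below the seed, each step going down an edge labelled (1,0).
    chain-colour : ∀ i j → j + i ≡ h → colour (vertex (zeros j , ones i)) ≡ link j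
    chain-colour zero j eq with refl ← trans (sym (+-identityʳ j)) eq =
      trans (cong toℕ (proj₁ (proj₂ tiling) (vertex (zeros h , [])) origin blank-labels))
        (toℕ-fromℕ< (n<1+n (link h)))
    chain-colour (suc i) j eq = rules-descend (subst
      (λ c → (colour (vertex (zeros j , ones (suc i))) , 1 , 0 , c) ∈ rules)
      (chain-colour i (suc j) (trans (sym (+-suc j i)) eq)) (move-rule (zeros j) (ones (suc i)) false))

    forced : ∀ {r α} → r ∈ rules → ∀ x β → Δ x ≡ α → Forced α x β r
    forced r∈ x β refl = rules-closed r∈ x β

    Holds : X → Tape → Set
    Holds x τ = T (member (colour (vertex (embed τ))) (index x))

    start-holds : ∀ z → Holds start (startTape fixedCode z)
    start-holds z = subst (λ c → T (member (toℕ c) (index start)))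
      (proj₁ tiling (vertex ([ true ] , ones (suc fixedCode))) (vertex (embed (startTape fixedCode z))) (start-≈ z))
      (rules-start (subst (λ c → (c , 1 , 1 , colour (vertex ([ true ] , ones (suc fixedCode)))) ∈ rules)
        (chain-colour (chainLength fixedCode) 0 (sym h-≡)) (move-rule [] (ones (chainLength fixedCode)) true)))

    step-holds : ∀ {x d w nx a τ τ′} → Δ x ≡ move d w nx → Move d a (w a) τ τ′ → Holds x τ → Holds (nx a) τ′
    step-holds {x} {w = w} eq (right {a = a} {l = l} {r} refl) t =
      forced (move-rule (l ++ [ true ]) r (w a)) x (hd r) eq t refl refl
    step-holds {x} {w = w} eq (left {a = a} {l = l} {r = r}) t =
      forced (move-rule (l ++ [ true ]) (w a ∷ r) a) x a eq t refl refl

    reach-holds : ∀ {x y τ τ′} → Reach Δ (x , τ) (y , τ′) → Holds x τ → Holds y τ′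
    reach-holds stop          t = t
    reach-holds (step eq m s) t = reach-holds s (step-holds eq m t)

    not-bad : ∀ {x τ} → Δ x ≡ bad → ¬ Holds x τ
    -- The upward edge that writes a 1 serves as the edge with this vertex as lower endpoint.
    not-bad {x} {l , r} eq = forced (move-rule (l ++ [ true ]) r true) x true eq

  bad⇒¬Tileable : ∀ {z x τ} → Reach Δ (start , startTape fixedCode z) (x , τ) → Δ x ≡ bad → ¬ Tileable tiles
  bad⇒¬Tileable {z} {x} {τ} reach eq (κ , tiling) = not-bad {x} {τ} eq (reach-holds reach (start-holds z))
    where open Forcing κ tiling

  -- A finite good run yields a tiling

  visits : ∀ {c d} → Reach Δ c d → List (X × Tape)
  visits {c} stop         = c ∷ []
  visits {c} (step _ _ s) = c ∷ visits s

  visits-head : ∀ {c d} (s : Reach Δ c d) → c ∈ visits s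
  visits-head stop         = here refl
  visits-head (step _ _ s) = here refl

  -- The visited configurations are closed under moves because the run ends in a good state, from
  -- which no further move is demanded.
  visits-step : ∀ {c y τ x σ} (s : Reach Δ c (y , τ)) → Δ y ≡ good → (x , σ) ∈ visits s
              → Δ x ≡ good ⊎ (∃ λ d → ∃ λ w → ∃ λ nx → ∃ λ a → ∃ λ σ′
                  → Δ x ≡ move d w nx × Move d a (w a) σ σ′ × (nx a , σ′) ∈ visits s)
  visits-step stop          halt (here refl) = inj₁ halt
  visits-step (step eq m s) halt (here refl) = inj₂ (_ , _ , _ , _ , _ , eq , m , there (visits-head s))
  visits-step (step _ _ s)  halt (there i) with visits-step s halt i
  ... | inj₁ g = inj₁ g
  ... | inj₂ (d , w , nx , a , σ′ , eq , m , i′) = inj₂ (d , w , nx , a , σ′ , eq , m , there i′)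

  -- The position of the mark: it carries 1 in every configuration of the run and 0 at every chain
  -- vertex except `chain 0`.
  cell₀ : ℤ
  cell₀ = + 0 ℤ.- + h

  embed-cell₀ : ∀ {v} σ → v ≈ embed σ → lab v cell₀ ≡ 1
  embed-cell₀ σ (_ , eq) = trans (eq cell₀) (trans (labelAt-cell _ 0) (cong bit (embed-mark σ)))

  chain-cell₀ : ∀ {v j r} → v ≈ (zeros (suc j) , r) → lab v cell₀ ≡ 0
  chain-cell₀ {j = j} {r} (_ , eq) = trans (eq cell₀) (trans (labelAt-cell _ 0) (cong bit (nth-zeros-ʳ++ j r)))

  chain-unique : ∀ {v i j r s} → v ≈ (zeros i , r) → v ≈ (zeros j , s) → i ≡ j
  chain-unique {i = i} {j} (p , _) (p′ , _) =
    trans (sym (length-replicate i)) (trans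
      (position-injective (length (zeros i)) (length (zeros j)) (trans (sym p) p′)) (length-replicate j))

  -- At `chain 0` the marker is too far left, since the machine stays beyond the mark; at every
  -- other chain vertex the mark is missing.
  chain-apart : ∀ {v} j σ → v ≈ chain j → ¬ (v ≈ embed σ)
  chain-apart zero    ([] , r)    (p , _) (p′ , _) =
    contradiction (position-injective 0 1 (trans (sym p) p′)) λ ()
  chain-apart zero    (_ ∷ l , r) (p , _) (p′ , _) =
    contradiction (position-injective 0 (suc (length (l ++ [ true ]))) (trans (sym p) p′)) λ ()
  chain-apart {v} (suc j) σ e e′ = contradiction
    (trans (sym (embed-cell₀ {v} σ e′)) (chain-cell₀ {v} {j} e)) λ ()

  bit-injective : ∀ {b c} → bit b ≡ bit c → b ≡ c
  bit-injective {false} {false} _ = refl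
  bit-injective {true}  {true}  _ = refl

  module Painting {z y τ} (reach : Reach Δ (start , startTape fixedCode z) (y , τ)) (halt : Δ y ≡ good) where

    Visited : Vertex p q → ℕ → Set
    Visited v i = ∃ λ c → c ∈ visits reach × (index (proj₁ c) ≡ i × v ≈ embed (proj₂ c))

    opaque
      visited? : ∀ v i → Dec (Visited v i)
      visited? v i = map′ find (λ (c , c∈ , e) → lose c∈ e)
        (any? (λ (x , σ) → (index x ≟ i) ×-dec (v ≈? embed σ)) (visits reach))

    set : Vertex p q → ℕ
    set v = setColour N (λ i → does (visited? v i))

    OnChain : Vertex p q → Set
    OnChain v = ∃ λ j → j < suc h × v ≈ chain j

    onChain? : ∀ v → Dec (OnChain v)
    onChain? v = anyUpTo? (λ j → v ≈? chain j) (suc h)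

    -- The decision is an argument so that the lemmas below can split on it and hold for any
    -- decision, `onChain? v` in particular.
    paint : ∀ v → Dec (OnChain v) → ℕ
    paint v (yes (j , _)) = link j
    paint v (no _)        = set v

    member⇒Visited : ∀ v d x → T (member (paint v d) (index x)) → Visited v (index x)
    member⇒Visited v (yes (j , _)) x t = contradiction t (member-link j (index x))
    member⇒Visited v (no _)        x t = toWitness {a? = visited? v (index x)}
      (subst T (trans (member-setColour N (λ i → does (visited? v i)) (index-< x))
        (sym (isYes≗does (visited? v (index x))))) t)

    Visited⇒member : ∀ v d x → Visited v (index x) → T (member (paint v d) (index x))
    Visited⇒member v (yes (j , _ , e)) x ((_ , σ) , _ , _ , e′) = contradiction e′ (chain-apart {v} j σ e)
    Visited⇒member v (no _) x vis =
      subst T (sym (trans (member-setColour N (λ i → does (visited? v i)) (index-< x))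
        (dec-true (visited? v (index x)) vis))) _

    paint-closed : ∀ v w → Edge v w → ∀ d e → Closed (paint v d , lab v (pos v) , lab w (pos v) , paint w e)
    paint-closed v w edge d e x β with Δ x in eq
    ... | good = _
    ... | bad = λ t → never (member⇒Visited v d x t)
      where
      never : ¬ Visited v (index x)
      never (_ , c∈ , i≡ , _) with refl ← index-injective i≡ | visits-step reach halt c∈
      ... | inj₁ g = contradiction (trans (sym eq) g) λ ()
      ... | inj₂ (_ , _ , _ , _ , _ , eq′ , _) = contradiction (trans (sym eq) eq′) λ ()
    ... | move ▸ wr nx = λ t aβ bβ → Visited⇒member w e (nx β) (go (member⇒Visited v d x t) aβ bβ)
      where
      go : Visited v (index x) → lab v (pos v) ≡ bit β → lab w (pos v) ≡ bit (wr β) → Visited w (index (nx β))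
      go (_ , c∈ , i≡ , v≈) aβ bβ with refl ← index-injective i≡ | visits-step reach halt c∈
      ... | inj₁ g = contradiction (trans (sym eq) g) λ ()
      ... | inj₂ (_ , _ , _ , _ , _ , eq′ , m , c∈′) with trans (sym eq) eq′
      -- The lower label identifies `β` with the symbol under the head, so this edge is the one
      -- along which the run continues.
      go (_ , c∈ , i≡ , v≈) aβ bβ | inj₂ (_ , _ , _ , _ , _ , eq′ , right {l = l} {r} refl , c∈′) | refl
        with refl ← bit-injective {β} {hd r} (trans (sym aβ) (≈-read {v} {l ++ [ true ]} {r} v≈)) =
        _ , c∈′ , refl , ≈-right {v} {w} {l ++ [ true ]} {r} v≈ edge bβ
    ... | move ◂ wr nx = λ t bβ aβ → Visited⇒member v d (nx β) (go (member⇒Visited w e x t) bβ aβ)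
      where
      go : Visited w (index x) → lab w (pos v) ≡ bit β → lab v (pos v) ≡ bit (wr β) → Visited v (index (nx β))
      go (_ , c∈ , i≡ , w≈) bβ aβ with refl ← index-injective i≡ | visits-step reach halt c∈
      ... | inj₁ g = contradiction (trans (sym eq) g) λ ()
      ... | inj₂ (_ , _ , _ , _ , _ , eq′ , m , c∈′) with trans (sym eq) eq′
      go (_ , c∈ , i≡ , w≈) bβ aβ | inj₂ (_ , _ , _ , _ , _ , eq′ , left {a = a} {l = l} {r = r} , c∈′) | refl
        with refl ← bit-injective {β} {a} (trans (sym bβ) (≈-write {v} {w} {a} {l ++ [ true ]} {r} w≈ edge)) =
        _ , c∈′ , refl , ≈-left {v} {w} {a} {_} {l ++ [ true ]} {r} w≈ edge aβ

    set-even : ∀ v → odd (set v) ≡ false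
    set-even v = odd-double (encode N (λ i → does (visited? v i)))

    set≢1 : ∀ v → set v ≢ 1
    set≢1 v eq = contradiction (trans (sym (set-even v)) (cong odd eq)) λ ()

    set-< : ∀ v → set v < colourBound
    set-< v = m≤n⇒m≤1+n (m≤n⇒m≤1+n (+-mono-< (encode-< N S) (encode-< N S)))
      where S = λ i → does (visited? v i)

    set-unvisited : ∀ v → lab v cell₀ ≢ 1 → set v ≡ 0
    set-unvisited v ne = cong (λ e → e + e) (encode-∅ N (λ i → dec-false (visited? v i)
      λ ((_ , σ) , _ , _ , e) → ne (embed-cell₀ {v} σ e)))

    label-<p : ∀ (v : Vertex p q) → lab v (pos v) < p
    label-<p v = above v (pos v) ℤ.≤-refl

    label-<q : ∀ (v w : Vertex p q) → Edge v w → lab w (pos v) < q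
    label-<q v w (pw , _) = below w (pos v)
      (ℤ.suc[i]≤j⇒i<j (ℤ.≤-reflexive (trans (ℤ.+-comm ℤ.1ℤ (pos v)) (sym pw))))

    -- Fixed rules serve the edges off the chain and those joining its bottom to the rest of the
    -- graph; all other edges use the template. The template demands colour 0 next to the chain,
    -- which is correct because the missing mark shows these neighbours to be unvisited.
    paint-rule : ∀ v w → Edge v w → ∀ d e → (paint v d , lab v (pos v) , lab w (pos v) , paint w e) ∈ rules
    paint-rule v w edge@(pw , agree) d@(no nv) e@(no nw) =
      fixed-rule (set-< v , label-<p v , label-<q v w edge , set-< w)
        ( paint-closed v w edge d e
        , (λ eq → contradiction eq (set≢1 v))
        , (λ _ _ t → ⊥-elim (subst T (set-even w) t)))
    paint-rule v w edge@(pw , agree) d@(no nv) e@(yes (zero , _ , w≈)) =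
      fixed-rule (set-< v , label-<p v , label-<q v w edge , s≤s (s≤s z≤n))
        ( paint-closed v w edge d e
        , (λ eq → contradiction eq (set≢1 v))
        , (λ _ _ _ → refl))
    paint-rule v w edge@(pw , agree) d@(no nv) e@(yes (suc j , s≤s j<h , w≈)) =
      subst₂ (λ c b → (c , lab v (pos v) , b , link (suc j)) ∈ rules)
        (sym (set-unvisited v unmarked)) (sym (≈-write {v} {w} {false} {zeros j} w≈ edge))
        (chain-rule j<h (lower (label-<p v) not-1))
      where
      not-1 : lab v (pos v) ≢ 1
      not-1 eq = nv (j , m≤n⇒m≤1+n j<h , subst (v ≈_) (sym (chain-next j<h))
        (≈-left {v} {w} {false} {true} {zeros j} w≈ edge eq))
      unmarked : lab v cell₀ ≢ 1
      -- Either the edge changes the cell of the mark, whose value at `v` is then not 1 by `not-1`,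
      -- or that cell is 0 as on the chain.
      unmarked eq with cell₀ ℤ.≟ pos v
      ... | yes p = not-1 (trans (cong (lab v) (sym p)) eq)
      ... | no ¬p = contradiction (trans (sym eq) (trans (agree cell₀ ¬p) (chain-cell₀ {w} {j} w≈))) λ ()
    paint-rule v w edge@(pw , agree) d@(yes (zero , _ , v≈)) e@(no nw) =
      fixed-rule (s≤s (s≤s z≤n) , label-<p v , label-<q v w edge , set-< w)
        ( paint-closed v w edge d e
        , (λ _ _ b≡1 → Visited⇒member w e start (_ , visits-head reach , refl ,
             ≈-trans {w} {vertex ([ true ] , ones (suc fixedCode))} {vertex (embed (startTape fixedCode z))}
               (≈-right {v} {w} {[]} {ones (chainLength fixedCode)}
               (subst (λ n → v ≈ ([] , ones n)) h-≡ v≈) edge b≡1) (start-≈ z)))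
        , (λ _ _ t → ⊥-elim (subst T (set-even w) t)))
      where
      ≈-trans : ∀ {u v w : Vertex p q} → SameVertex u v → SameVertex v w → SameVertex u w
      ≈-trans (p , f) (p′ , g) = trans p p′ , λ i → trans (f i) (g i)
    paint-rule v w edge@(pw , agree) d@(yes (suc j , s≤s j<h , v≈)) e@(no nw) =
      subst (λ c → (link (suc j) , lab v (pos v) , lab w (pos v) , c) ∈ rules)
        (sym (set-unvisited w unmarked)) (chain-rule j<h (upper (label-<p v) (label-<q v w edge)))
      where
      apart : cell₀ ≢ pos v
      apart eq = contradiction (position-injective 0 (suc (length (zeros j))) (trans eq (proj₁ v≈))) λ ()
      unmarked : lab w cell₀ ≢ 1
      unmarked eq = contradiction (trans (sym eq) (trans (sym (agree cell₀ apart)) (chain-cell₀ {v} {j} v≈))) λ ()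
    paint-rule v w edge@(pw , agree) (yes (j , _ , v≈)) (yes (j′ , s≤s j′≤h , w≈))
      -- Comparing markers: `j′` is the successor of `j`.
      with refl ← trans (sym (length-replicate j′)) (trans
             (position-injective (length (zeros j′)) (suc (length (zeros j)))
               (trans (sym (proj₁ w≈)) (trans pw
                 (trans (cong (ℤ._+ ℤ.1ℤ) (proj₁ v≈)) (sym (suc-position (length (zeros j))))))))
             (cong suc (length-replicate j))) =
      subst₂ (λ a b → (link j , a , b , link (suc j)) ∈ rules)
        (sym (≈-read {v} {zeros j} {true ∷ _} (subst (v ≈_) (chain-next j′≤h) v≈)))
        (sym (≈-write {v} {w} {false} {zeros j} w≈ edge))
        (chain-rule j′≤h descend)

    paint-resp : ∀ v w → SameVertex v w → ∀ d e → paint v d ≡ paint w e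
    paint-resp v w s (yes (i , _ , v≈)) (yes (j , _ , w≈)) =
      cong link (chain-unique {w} {i} {j} {ones (h ∸ i)} {ones (h ∸ j)} (≈-resp v w (chain i) s v≈) w≈)
    paint-resp v w s (yes (i , l , v≈)) (no nw) = contradiction (i , l , ≈-resp v w (chain i) s v≈) nw
    paint-resp v w (p , f) (no nv) (yes (j , l , w≈)) =
      contradiction (j , l , ≈-resp w v (chain j) (sym p , λ i → sym (f i)) w≈) nv
    paint-resp v w s@(p , f) (no _) (no _) = cong (λ e → e + e) (encode-cong N λ i →
      does-⇔ (mk⇔ (λ (c , c∈ , i≡ , e) → c , c∈ , i≡ , ≈-resp v w (embed (proj₂ c)) s e)
                  (λ (c , c∈ , i≡ , e) → c , c∈ , i≡ , ≈-resp w v (embed (proj₂ c)) (sym p , λ i → sym (f i)) e))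
        (visited? v i) (visited? w i))

    paint-seed : ∀ v → pos v ≡ + 0 → (∀ i → lab v i ≡ 0) → ∀ d → paint v d ≡ link h
    -- `paint-resp` with `v` on both sides exchanges the given decision for the one that places `v`
    -- at the top of the chain.
    paint-seed v p f d = paint-resp v v (refl , λ _ → refl) d (yes (h , ≤-refl , seed))
      where
      seed : v ≈ chain h
      seed = subst (λ n → v ≈ (zeros h , ones n)) (sym (n∸n≡0 h))
        (trans p (sym origin) , λ i → trans (f i) (sym (blank-labels i)))

    paint-< : ∀ v d → paint v d < colours
    paint-< v (yes (j , s≤s j≤h , _)) = s≤s (link-mono j≤h)
    paint-< v (no _) = <-≤-trans (set-< v) colourBound≤colours

    colouring : Vertex p q → Fin colours
    colouring v = fromℕ< (paint-< v (onChain? v))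

    toℕ-colouring : ∀ v → toℕ (colouring v) ≡ paint v (onChain? v)
    toℕ-colouring v = toℕ-fromℕ< (paint-< v (onChain? v))

    tileable : Tileable tiles
    tileable = colouring
      , (λ v w s → toℕ-injective (trans (toℕ-colouring v)
          (trans (paint-resp v w s (onChain? v) (onChain? w)) (sym (toℕ-colouring w)))))
      , (λ v p f → toℕ-injective (trans (toℕ-colouring v)
          (trans (paint-seed v p f (onChain? v)) (sym (toℕ-fromℕ< (n<1+n (link h)))))))
      , edges
      where
      edges : ∀ v w → Edge v w → Σ (Fin p) λ a → Σ (Fin q) λ b → (toℕ a ≡ lab v (pos v))
            × (toℕ b ≡ lab w (pos v)) × ((colouring v , a , b , colouring w) ∈ Π tiles)
      edges v w edge with ∈-map⁻ (erase {colours} {p} {q})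
        (subst ((paint v (onChain? v) , lab v (pos v) , lab w (pos v) , paint w (onChain? w)) ∈_)
          (sym erase-tileRules) (paint-rule v w edge (onChain? v) (onChain? w)))
      ... | (c , a , b , d) , r∈ , eq =
        a , b , sym (cong (proj₁ ∘ proj₂) eq) , sym (cong (proj₁ ∘ proj₂ ∘ proj₂) eq) ,
        subst₂ (λ c d → (c , a , b , d) ∈ Π tiles)
          (toℕ-injective (trans (sym (cong proj₁ eq)) (sym (toℕ-colouring v))))
          (toℕ-injective (trans (sym (cong (proj₂ ∘ proj₂ ∘ proj₂) eq)) (sym (toℕ-colouring w)))) r∈

  good⇒Tileable : ∀ {z x τ} → Reach Δ (start , startTape fixedCode z) (x , τ) → Δ x ≡ good → Tileable tiles
  good⇒Tileable reach halt = Painting.tileable reach halt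

-- Undecidability

⊥-finite : Finite ⊥
⊥-finite = record
  { N = 0 ; index = λ () ; index-< = λ () ; index-injective = λ { {()} }
  ; states = [] ; listed = λ () }

⊤-finite : Finite ⊤
⊤-finite = record
  { N = 1 ; index = λ _ → 0 ; index-< = λ _ → z<s ; index-injective = λ _ → refl
  ; states = tt ∷ [] ; listed = λ _ → here refl }

⊎-finite : ∀ {A B} → Finite A → Finite B → Finite (A ⊎ B)
⊎-finite {A} {B} FA FB = record
  { N               = F.N + G.N
  ; index           = index
  ; index-<         = λ { (inj₁ a) → <-≤-trans (F.index-< a) (m≤m+n F.N G.N)
                        ; (inj₂ b) → +-monoʳ-< F.N (G.index-< b) }
  ; index-injective = λ {x} {y} → injective x y
  ; states          = List.map inj₁ F.states ++ List.map inj₂ G.states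
  ; listed          = λ { (inj₁ a) → ∈-++⁺ˡ (∈-map⁺ inj₁ (F.listed a))
                        ; (inj₂ b) → ∈-++⁺ʳ (List.map inj₁ F.states) (∈-map⁺ inj₂ (G.listed b)) }
  }
  where
  module F = Finite FA
  module G = Finite FB
  index : A ⊎ B → ℕ
  index (inj₁ a) = F.index a
  index (inj₂ b) = F.N + G.index b
  apart : ∀ a b → F.index a ≢ F.N + G.index b
  apart a b eq = <⇒≢ (<-≤-trans (F.index-< a) (m≤m+n F.N (G.index b))) eq
  injective : ∀ x y → index x ≡ index y → x ≡ y
  injective (inj₁ a) (inj₁ a′) eq = cong inj₁ (F.index-injective eq)
  injective (inj₁ a) (inj₂ b)  eq = contradiction eq (apart a b)
  injective (inj₂ b) (inj₁ a)  eq = contradiction (sym eq) (apart a b)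
  injective (inj₂ b) (inj₂ b′) eq = cong inj₂ (G.index-injective (+-cancelˡ-≡ F.N _ _ eq))

State-finite : ∀ t → Finite (State t)
State-finite done         = ⊥-finite
State-finite (s ⨾ t)      = ⊎-finite (State-finite s) (State-finite t)
State-finite (scan _ _)   = ⊤-finite
State-finite (rd _ _ s t) = ⊎-finite ⊤-finite (⊎-finite (State-finite s) (State-finite t))
State-finite (iter s t u) =
  ⊎-finite ⊤-finite (⊎-finite (State-finite s) (⊎-finite (State-finite t) (State-finite u)))

module Decider (f : PR 1) where

  cmd : Cmd
  cmd = compile f (0 ∷ []) 1 2

  -- The summand 2 guarantees that registers 0 and 1, input and output, are present, and makes the
  -- register list split into these two and the rest by computation.
  width-cmd : ℕ
  width-cmd = 2 + width cmd

  -- setup overwrites the first of the n + 1 ones to the right of the mark, which leaves 0 1ⁿ.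
  setup main : Prog
  setup = rd ▸ (const false) done done ⨾ rd ◂ id done done
  main  = setup ⨾ toProg width-cmd cmd ⨾ rep 2 skipʳ

  X : Set
  X = State main ⊎ (⊤ ⊎ (⊤ ⊎ ⊤))

  pattern test   = inj₂ (inj₁ tt)
  pattern accept = inj₂ (inj₂ (inj₁ tt))
  pattern reject = inj₂ (inj₂ (inj₂ tt))

  Δ : X → Action X
  Δ (inj₁ s) = act main inj₁ test s
  -- The head stands at the first cell of register 1, which is 1 exactly when the output is nonzero.
  -- The answer 1, claiming a tiling, thus leads to the state that excludes one.
  Δ test     = move ▸ id (λ a → if a then reject else accept)
  Δ accept   = good
  Δ reject   = bad

  machine : Machine
  machine = record
    { X      = X
    ; X-finite = ⊎-finite (State-finite main) (⊎-finite ⊤-finite (⊎-finite ⊤-finite ⊤-finite))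
    ; Δ      = Δ
    ; start  = entry main inj₁ test
    }

  input : ℕ → Reg
  input n zero    = n
  input n (suc _) = 0

  enc-zeros : ∀ m {ρ} → (∀ i → ρ i ≡ 0) → enc (regs m ρ) ≡ zeros m
  enc-zeros zero    z = refl
  enc-zeros (suc m) z = cong₂ (λ r u → false ∷ ones r ++ u) (z 0) (enc-zeros m (z ∘ suc))

  hd-ones : ∀ y {Q} → hd Q ≡ false → hd (ones y ++ Q) ≡ hd (ones y)
  hd-ones zero    z = z
  hd-ones (suc _) z = refl

  run : ∀ {n y} → f ⟦ n ∷ [] ⟧⇓ y → ∃ λ τ → hd (proj₂ τ) ≡ hd (ones y)
      × Reach Δ (entry main inj₁ test , startTape n (suc (width cmd))) (test , τ)
  run {n} {y} ev
    with toProg-correct {width-cmd} (m≤n+m (width cmd) 2)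
           (compile-correct f {ρ = input n} (z<s ∷ []) ((λ ()) ∷ []) ≤-refl
             (λ { (s≤s _) → refl }) refl ev)
           (0 , cong ([] ,_) (sym (trans (++-identityʳ _)
             (cong (λ u → false ∷ ones n ++ u) (enc-zeros (suc (width cmd)) {input n ∘ suc} (λ _ → refl))))))
  ... | _ , ex , m , refl = _ , value ,
    Exec⇒Reach inj₁ test (λ _ → refl)
      ((rd₁ (right refl) done ⨾ rd₀ left done) ⨾ ex ⨾ enter (σ 0 ∷ []) (σ 1) ys)
    where
    σ = input n ⊕ y · 1
    ys = regs (width cmd) (σ ∘ suc ∘ suc)
    value : hd (ones (σ 1) ++ enc ys ++ zeros m) ≡ hd (ones y)
    value = trans (cong (λ r → hd (ones r ++ enc ys ++ zeros m)) (*-identityʳ y))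
      (hd-ones y (hd-enc ys (hd-zeros m)))

  run-1 : ∀ {n} → f ⟦ n ∷ [] ⟧⇓ 1
        → ∃ λ τ → Reach Δ (entry main inj₁ test , startTape n (suc (width cmd))) (reject , τ)
  run-1 ev with run ev
  ... | _ , one , reach = _ , Reach-trans reach (step refl (right one) stop)

  run-0 : ∀ {n} → f ⟦ n ∷ [] ⟧⇓ 0
        → ∃ λ τ → Reach Δ (entry main inj₁ test , startTape n (suc (width cmd))) (accept , τ)
  run-0 ev with run ev
  ... | _ , nil , reach = _ , Reach-trans reach (step refl (right nil) stop)

theorem7p1 : (p q : ℕ) → 2 ≤ p → 2 ≤ q →
    ¬ Σ (PR 1) (λ f → Decides {p} {q} f)
theorem7p1 p q 2≤p 2≤q (f , decides) = refute (decides tiles)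
  where
  open Decider (comp f (proj₁ (selfCodeᶜ (template p q)) ∷ []))
  open Tiling machine 2≤p 2≤q
  open Rules machine 2≤p 2≤q using (fixedCode)
  -- At the argument `fixedCode` the inner function returns the code of `tiles`, so the machine
  -- evaluates `f` on the instance built from the machine itself.
  self : ∀ {y} → f ⟦ code tiles ∷ [] ⟧⇓ y
       → comp f (proj₁ (selfCodeᶜ (template p q)) ∷ []) ⟦ fixedCode ∷ [] ⟧⇓ y
  self {y} ev = ev-comp (ev-∷ (proj₂ (selfCodeᶜ (template p q)) _) ev-[])
    (subst (λ c → f ⟦ c ∷ [] ⟧⇓ y) code-tiles ev)
  refute : _ → ⊥
  refute (inj₁ (ev , tileable))  = bad⇒¬Tileable (proj₂ (run-1 (self ev))) refl tileable
  refute (inj₂ (ev , ¬tileable)) = ¬tileable (good⇒Tileable (proj₂ (run-0 (self ev))) refl)
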